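{- Let $m\in\mathbb{N}$, let $h:\mathbb{N}^m\to\mathbb{N}$ be a polynomial having no constant term, and let $A\subseteq\mathbb{N}$. The following statements are equivalent. (1) There exist functions $\alpha:\mathcal{P}_f(\mathbb{N}^{\mathbb{N}})\to\mathbb{N}$ and $H:\mathcal{P}_f(\mathbb{N}^{\mathbb{N}})\to\mathcal{P}_f(\mathbb{N})$ such that (a) if $F,G\in\mathcal{P}_f(\mathbb{N}^{\mathbb{N}})$ and $F\subsetneq G$, then $\max H(F)<\min H(G)$; and (b) whenever $(G_i)_{i\in\mathbb{N}}$ is a sequence in $\mathcal{P}_f(\mathbb{N}^{\mathbb{N}})$ with $G_1\subsetneq G_2\subsetneq\cdots\subsetneq G_n\subsetneq\cdots$, then for all $\beta_1<\cdots<\beta_m$ in $\mathcal{P}_f(\mathbb{N})$ and all choices of $f_i\in G_i$ ($i\in\mathbb{N}$), one has $$h\left(\sum_{i\in\beta_1}\Bigl(\alpha(G_i)+\sum_{t\in H(G_i)}f_i(t)\Bigr),\ldots,\sum_{i\in\beta_m}\Bigl(\alpha(G_i)+\sum_{t\in H(G_i)}f_i(t)\Bigr)\right)\in A.$$ (2) There exists an idempotent $p$ in $(\mathcal{J},+)$ such that $A\in\tilde h\left(\bigotimes_{i=1}^m p\right)$.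
   Context: $\mathbb{N}$ is the set of positive integers; $\mathcal{P}_f(X)$ is the set of nonempty finite subsets of $X$; $\mathbb{N}^{\mathbb{N}}$ is the set of all functions $\mathbb{N}\to\mathbb{N}$. For $\beta,\gamma\in\mathcal{P}_f(\mathbb{N})$, $\beta<\gamma$ means $\max\beta<\min\gamma$. $\beta X$ denotes the set of ultrafilters on a discrete set $X$ (Stone–Čech compactification). On $\beta\mathbb{N}$: $A\in p+q$ iff $\{x\in\mathbb{N}:-x+A\in q\}\in p$, where $-x+A=\{y\in\mathbb{N}:x+y\in A\}$. An ultrafilter $p$ is idempotent if $p+p=p$. For a map $h:\mathbb{N}^m\to\mathbb{N}$, $\tilde h:\beta(\mathbb{N}^m)\to\beta\mathbb{N}$ is its continuous extension: $A\in\tilde h(u)$ iff $h^{ -1}(A)\in u$. A set $A\subseteq\mathbb{N}$ is a $J$-set if for every $F\in\mathcal{P}_f(\mathbb{N}^{\mathbb{N}})$ there exist $a\in\mathbb{N}$ and $\beta\in\mathcal{P}_f(\mathbb{N})$ such that $a+\sum_{t\in\beta}f(t)\in A$ for all $f\in F$. $\mathcal{J}=\{p\in\beta\mathbb{N}:\text{every }A\in p\text{ is a }J\text{ -set}\}$; it is a two-sided ideal of $(\beta\mathbb{N},+)$. Tensor products: for ultrafilters $p_1,\ldots,p_k$ on $\mathbb{N}$, $\bigotimes_{i=1}^k p_i$ is the ultrafilter on $\mathbb{N}^k$ defined recursively by $\bigotimes_{i=1}^1p_i=p_1$, and, for $A\subseteq\mathbb{N}^{k+1}$, $A\in\bigotimes_{i=1}^{k+1}p_i$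 iff $\{(x_1,\ldots,x_k)\in\mathbb{N}^k:\{x_{k+1}\in\mathbb{N}:(x_1,\ldots,x_{k+1})\in A\}\in p_{k+1}\}\in\bigotimes_{i=1}^kp_i$. $\bigotimes_{i=1}^mp$ is the case $p_i=p$ for all $i$. -}

module Defs where

open import Data.Empty using (⊥-elim)
open import Data.Fin.Base using (Fin; inject₁; fromℕ)
open import Data.Integer.Base using (+_)
open import Data.List.Base using (List; foldr)
open import Data.List.Membership.Propositional using () renaming (_∈_ to _∈ₗ_)
open import Data.List.NonEmpty.Base as List⁺ using (List⁺)
open import Data.List.Relation.Unary.All using (All)
open import Data.List.Relation.Unary.Unique.Propositional using (Unique)
open import Data.Nat.Base as ℕ using (ℕ; zero; suc; NonZero; _⊔_; _⊓_)
open import Data.Product.Base using (Σ-syntax; _×_; _,_)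
open import Data.Rational.Base as ℚ using (ℚ; 0ℚ)
open import Data.Sum.Base as Sum using (_⊎_)
open import Data.Vec.Base as Vec using (Vec; []; _∷_; _∷ʳ_)
open import Function.Base using (id; _∘_)
open import Function.Bundles using (_⇔_)
open import Level using (0ℓ) renaming (suc to lsuc)
open import Relation.Binary.Bundles using (Setoid)
open import Relation.Binary.PropositionalEquality.Core using (_≡_; _≢_)
open import Relation.Nullary.Negation.Core using (¬_)
open import Relation.Unary using (Pred; _∈_; _⊆_; _∩_; ∁; ∅; U; _⊢_)

-- The positive integers.  The proof of positivity is irrelevant, so two
-- elements with equal values are propositionally equal.

record ℕ⁺ : Set where
  constructor mkℕ⁺
  field
    value        : ℕ
    .{{nonZero}} : NonZero value

open ℕ⁺ public using (value)

private
  +-nonZero : ∀ m n → .{{NonZero m}} → NonZero (m ℕ.+ n)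
  +-nonZero (suc _) _ = _

infixl 6 _+_

_+_ : ℕ⁺ → ℕ⁺ → ℕ⁺
mkℕ⁺ a + mkℕ⁺ b = mkℕ⁺ (a ℕ.+ b) {{+-nonZero a b}}

suc⁺ : ℕ⁺ → ℕ⁺
suc⁺ i = mkℕ⁺ (suc (value i))

Fun : Set
Fun = ℕ⁺ → ℕ⁺

-- A nonempty finite subset is presented by a repetition-free enumeration
-- of its elements.  Enumerations of the same set are identified
-- by _≈f_ below; a function on 𝒫f X is a setoid map out of 𝒫f-setoid X.

record 𝒫f (X : Set) : Set where
  constructor mk𝒫f
  field
    elements : List⁺ X
    distinct : Unique (List⁺.toList elements)

open 𝒫f public using (elements)

module _ {X : Set} where

  infix 4 _∈f_ _⊆f_ _≈f_ _⊊f_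

  _∈f_ : X → 𝒫f X → Set
  x ∈f F = x ∈ₗ List⁺.toList (elements F)

  _⊆f_ _≈f_ _⊊f_ : 𝒫f X → 𝒫f X → Set
  F ⊆f G = ∀ {x} → x ∈f F → x ∈f G
  F ≈f G = (F ⊆f G) × (G ⊆f F)
  F ⊊f G = (F ⊆f G) × ¬ (F ≈f G)

  -- Each element is counted once, because the enumeration has no repetitions.
  ∑ : 𝒫f X → (X → ℕ⁺) → ℕ⁺
  ∑ F g = List⁺.foldr₁ _+_ (List⁺.map g (elements F))

𝒫f-setoid : Set → Setoid 0ℓ 0ℓ
𝒫f-setoid X = record
  { Carrier       = 𝒫f X
  ; _≈_           = _≈f_
  ; isEquivalence = record
    { refl  = id , id
    ; sym   = λ (p , q) → q , p
    ; trans = λ (p , q) (r , s) → (λ x → r (p x)) , (λ x → q (s x))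
    }
  }

max min : 𝒫f ℕ⁺ → ℕ
max β = List⁺.foldr₁ _⊔_ (List⁺.map value (elements β))
min β = List⁺.foldr₁ _⊓_ (List⁺.map value (elements β))

infix 4 _<f_

_<f_ : 𝒫f ℕ⁺ → 𝒫f ℕ⁺ → Set
β <f γ = max β ℕ.< min γ

-- A polynomial in m variables is a formal sum of monomials c · x₁^e₁ ⋯ xₘ^eₘ.
-- A real polynomial that maps (ℕ⁺)^m into ℕ⁺ has rational coefficients, by
-- interpolation, so ℚ loses no such map.

Polynomial : ℕ → Set
Polynomial m = List (ℚ × Vec ℕ m)

power : ∀ {m} → Vec ℕ⁺ m → Vec ℕ m → ℕ
power xs es = Vec.foldr′ ℕ._*_ 1 (Vec.zipWith (λ x e → value x ℕ.^ e) xs es)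

ℕ→ℚ : ℕ → ℚ
ℕ→ℚ n = + n ℚ./ 1

evaluate : ∀ {m} → Polynomial m → Vec ℕ⁺ m → ℚ
evaluate P xs = foldr (λ (c , es) s → (c ℚ.* ℕ→ℚ (power xs es)) ℚ.+ s) 0ℚ P

NoConstantTerm : ∀ {m} → Polynomial m → Set
NoConstantTerm {m} P = All (λ (_ , es) → es ≢ Vec.replicate m 0) P

IsPolynomialWithoutConstantTerm : ∀ {m} → (Vec ℕ⁺ m → ℕ⁺) → Set
IsPolynomialWithoutConstantTerm {m} h =
  Σ[ P ∈ Polynomial m ]
    NoConstantTerm P × (∀ xs → ℕ→ℚ (value (h xs)) ≡ evaluate P xs)

-- Closure under supersets makes membership respect extensional equality
-- of subsets.

record Ultrafilter (X : Set) : Set₁ where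
  infix 4 _∋_
  field
    _∋_    : Pred (Pred X 0ℓ) 0ℓ
    ∋-U    : _∋_ U
    ∌-∅    : ¬ _∋_ ∅
    upward : ∀ {A B} → A ⊆ B → _∋_ A → _∋_ B
    ∋-∩    : ∀ {A B} → _∋_ A → _∋_ B → _∋_ (A ∩ B)
    ultra  : ∀ A → _∋_ A ⊎ _∋_ (∁ A)

infix 4 _∋_ _≈ᵤ_

_∋_ : ∀ {X} → Ultrafilter X → Pred X 0ℓ → Set
_∋_ = Ultrafilter._∋_

_≈ᵤ_ : ∀ {X} → Ultrafilter X → Ultrafilter X → Set₁
p ≈ᵤ q = ∀ A → p ∋ A ⇔ q ∋ A

-- The continuous extension h̃ : βX → βY of h.

extension : ∀ {X Y} → (X → Y) → Ultrafilter X → Ultrafilter Y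
extension h u = record
  { _∋_    = λ A → u ∋ (h ⊢ A)
  ; ∋-U    = ∋-U
  ; ∌-∅    = ∌-∅
  ; upward = λ A⊆B → upward (λ x∈ → A⊆B x∈)
  ; ∋-∩    = ∋-∩
  ; ultra  = λ A → ultra (h ⊢ A)
  }
  where open Ultrafilter u hiding (_∋_)

-- A ∈ limit p q op  iff  {x : {y : op x y ∈ A} ∈ q} ∈ p.  Both the sum
-- (op = _+_) and the recursive step of the tensor product (op = _∷ʳ_) are
-- of this form.

limit : ∀ {X Y Z} → Ultrafilter X → Ultrafilter Y → (X → Y → Z) → Ultrafilter Z
limit p q op = record
  { _∋_    = λ A → p ∋ (λ x → q ∋ (λ y → op x y ∈ A))
  ; ∋-U    = P.upward (λ _ → Q.∋-U) P.∋-U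
  ; ∌-∅    = λ e → P.∌-∅ (P.upward (λ n → ⊥-elim (Q.∌-∅ n)) e)
  ; upward = λ A⊆B → P.upward (Q.upward (λ a → A⊆B a))
  ; ∋-∩    = λ a b → P.upward (λ (c , d) → Q.∋-∩ c d) (P.∋-∩ a b)
  ; ultra  = λ A → Sum.map₂
      (P.upward (λ {x} ¬q → Sum.[ (λ a → ⊥-elim (¬q a)) , id ]
                              (Q.ultra (λ y → op x y ∈ A))))
      (P.ultra (λ x → q ∋ (λ y → op x y ∈ A)))
  }
  where
    module P = Ultrafilter p
    module Q = Ultrafilter q

infixl 6 _⊕_

_⊕_ : Ultrafilter ℕ⁺ → Ultrafilter ℕ⁺ → Ultrafilter ℕ⁺
p ⊕ q = limit p q _+_

Idempotent : Ultrafilter ℕ⁺ → Set₁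
Idempotent p = p ⊕ p ≈ᵤ p

-- The tensor product of a nonempty finite family.  For k = 1 the product is
-- transported along the bijection x ↦ x ∷ [].

⨂ : ∀ {X} k .{{_ : NonZero k}} → (Fin k → Ultrafilter X) → Ultrafilter (Vec X k)
⨂ (suc zero)    p = extension (_∷ []) (p (fromℕ 0))
⨂ (suc (suc k)) p = limit (⨂ (suc k) (p ∘ inject₁)) (p (fromℕ (suc k))) _∷ʳ_

IsJSet : Pred ℕ⁺ 0ℓ → Set
IsJSet A = (F : 𝒫f Fun) → Σ[ a ∈ ℕ⁺ ] Σ[ β ∈ 𝒫f ℕ⁺ ] (∀ f → f ∈f F → (a + ∑ β f) ∈ A)

𝒥 : Pred (Ultrafilter ℕ⁺) (lsuc 0ℓ)
𝒥 p = ∀ A → p ∋ A → IsJSet A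

module Submission where

-- Only B = h⁻¹(A) ⊆ ℕᵐ matters.
--
-- (1) ⇒ (2).  For F ∈ 𝒫f(ℕ^ℕ) let T(F) be the set of sums of the terms
-- α(Gᵢ) + ∑_{t ∈ H(Gᵢ)} fᵢ(t) over finite chains F ⊊ G₁ ⊊ ⋯ ⊊ Gₙ with fᵢ ∈ Gᵢ.
-- The closures of the T(F) meet in a compact semigroup Q.  An idempotent p in
-- a minimal left ideal of Q lies in 𝒥: given F₀, allow a variable among the
-- letters fᵢ and let Q′ be the corresponding semigroup of words with at least
-- one variable; p, viewed as an ultrafilter of constant words, has an idempotent
-- e ∈ Q′p, and by minimality p·e is sent to p by each substitution of some
-- f ∈ F₀ for the variable.  Hence each member of p contains, for some word
-- a + ∑_{t ∈ β} v(t), all its substitution instances with v ∈ F₀.  As every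
-- T(F) belongs to p, the m-tuples of consecutive chain sums form a member
-- of ⨂ p, and they lie in B.
--
-- All of this is phrased with filters: a filter φ stands for the closed set of
-- ultrafilters containing it, so minimal closed sets are maximal filters.
--
-- (2) ⇒ (1).  α and H are chosen by recursion on ⊊ so that every partial tuple
-- of block sums that can arise stays a p-large position of the game "pick
-- x₁, …, xₘ with (x₁, …, xₘ) ∈ B"; only finitely many positions arise from the
-- proper subsets of F, and a set in p ∈ 𝒥 is a J-set.

open import Algebra.Properties.CommutativeSemigroup using (interchange; xy∙z≈xz∙y)
open import Axiom.ExcludedMiddle using (ExcludedMiddle)
open import Axiom.Extensionality.Propositional using (Extensionality)
open import Data.Bool.Base using (Bool; true; false; T)
open import Data.Empty using (⊥-elim)
open import Data.List.Base as List using (List; []; _∷_; _++_; foldr)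
open import Data.List.Membership.Propositional using () renaming (_∈_ to _∈ₗ_)
open import Data.List.Membership.Propositional.Properties
  using (∈-++⁺ˡ; ∈-++⁺ʳ; ∈-++⁻; ∈-map⁺; ∈-map⁻; ∈-concatMap⁺; ∈-deduplicate⁺)
open import Data.List.NonEmpty.Base as List⁺ using (List⁺)
import Data.List.NonEmpty.Properties as List⁺
open import Data.List.Properties using (map-++)
open import Data.List.Relation.Binary.Permutation.Propositional using (_↭_; ↭-sym; ↭⇒↭ₛ)
open import Data.List.Relation.Binary.Permutation.Propositional.Properties using (∈-resp-↭; map⁺)
open import Data.List.Relation.Binary.Permutation.Setoid.Properties using (Unique-resp-↭)
import Data.List.Relation.Unary.All as ListAll
open import Data.List.Relation.Unary.AllPairs as AllPairs using (AllPairs; []; _∷_)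
open import Data.List.Relation.Unary.Any as Any using (here; there)
open import Data.List.Relation.Unary.Linked.Properties using (Linked⇒AllPairs)
open import Data.List.Relation.Unary.Unique.DecPropositional.Properties using (deduplicate-!)
open import Data.List.Relation.Unary.Unique.Propositional using (Unique)
import Data.List.Relation.Unary.Unique.Propositional.Properties as Unique
import Data.List.Sort as Sort
open import Data.Nat.Base as ℕ using (ℕ; zero; suc; NonZero; _≤_; _<_; z≤n; s≤s)
open import Data.Nat.ListAction using (sum)
open import Data.Nat.ListAction.Properties using (sum-++; sum-↭)
import Data.Nat.Properties as ℕ
open import Data.Product.Base using (Σ-syntax; ∃; _×_; _,_; proj₁; proj₂)
open import Data.Sum.Base as Sum using (_⊎_; inj₁; inj₂; [_,_])
open import Data.Unit.Base using (⊤)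
open import Data.Vec.Base using (Vec; []; _∷_; _∷ʳ_; head; tail; map)
open import Data.Vec.Relation.Unary.Linked using (Linked; []; [-]; _∷_)
open import Function.Base using (const; id; _∘_)
open import Function.Bundles using (_⇔_; _⟶ₛ_; _⟨$⟩_; mk⇔; Equivalence)
open import Induction.WellFounded using (Acc; acc; WellFounded; WfRec; module All; module FixPoint)
open import Level using (0ℓ; _⊔_) renaming (suc to lsuc)
open import Relation.Binary.Bundles using (Setoid)
import Relation.Binary.Construct.On as On
open import Relation.Binary.PropositionalEquality
  using (setoid; _≡_; refl; sym; trans; cong; cong₂; subst; subst₂; module ≡-Reasoning)
open import Relation.Nullary using (Dec; yes; no; ¬_; contradiction; True; toWitness; fromWitness; ⌊_⌋)
open import Relation.Nullary.Decidable using (decidable-stable; toSum)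
open import Relation.Unary using (Pred; _∈_; _⊆_; _∩_; ∁; ∅; U)
open import Defs

module Classical (em : ∀ ℓ → ExcludedMiddle ℓ) (ext : ∀ a b → Extensionality a b) where

  -- Classical logic

  decide : ∀ {ℓ} (P : Set ℓ) → Dec P
  decide {ℓ} P = em ℓ

  byContradiction : ∀ {ℓ} {P : Set ℓ} → ¬ ¬ P → P
  byContradiction {P = P} = decidable-stable (decide P)

  -- Excluded middle makes every type logically equivalent to a small one.
  Resize : ∀ {ℓ} → Set ℓ → Set
  Resize P = True (decide P)

  pack : ∀ {ℓ} {P : Set ℓ} → P → Resize P
  pack {P = P} = fromWitness {a? = decide P}

  unpack : ∀ {ℓ} {P : Set ℓ} → Resize P → P
  unpack {P = P} = toWitness {a? = decide P}

  ⌊⌋-cong : ∀ {a b} {P : Set a} {Q : Set b} → (P → Q) → (Q → P) → ⌊ decide P ⌋ ≡ ⌊ decide Q ⌋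
  ⌊⌋-cong {P = P} {Q} f g with decide P | decide Q
  ... | yes _ | yes _ = refl
  ... | no  _ | no  _ = refl
  ... | yes p | no ¬q = contradiction (f p) ¬q
  ... | no ¬p | yes q = contradiction (g q) ¬p

  -- Maximal filters

  module Hausdorff {Y : Set₁}
    (Φ : Pred (Pred Y 0ℓ) (lsuc 0ℓ)) (base : Pred Y 0ℓ) (Φ-base : Φ base)
    where

    infix 4 _≼_

    _≼_ : Pred Y 0ℓ → Pred Y 0ℓ → Set₁
    x ≼ y = ∀ A → x A → y A

    ⋃ : Pred (Pred Y 0ℓ) 0ℓ → Pred Y 0ℓ
    ⋃ C A = Resize (Σ[ x ∈ Pred Y 0ℓ ] C x × x A)

    Chain : Pred (Pred Y 0ℓ) 0ℓ → Set₁
    Chain C = ∀ {x y} → C x → C y → x ≼ y ⊎ y ≼ x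

    ⋃-upper : ∀ {C x} → C x → x ≼ ⋃ C
    ⋃-upper {x = x} Cx A a = pack (x , Cx , a)

    ⋃-least : ∀ {C y} → (∀ {x} → C x → x ≼ y) → ⋃ C ≼ y
    ⋃-least C≼y A a with _ , Cx , xA ← unpack a = C≼y Cx A xA

    -- The improvement of x is chosen from the characteristic function of x,
    -- so that it depends only on the extension of x.
    χ : Pred Y 0ℓ → Y → Bool
    χ x A = ⌊ decide (x A) ⌋

    Improvement : (Y → Bool) → Set₁
    Improvement b = Σ[ y ∈ Pred Y 0ℓ ]
      Φ y × (∀ A → T (b A) → y A) × ¬ (∀ A → y A → T (b A))

    improve : (Y → Bool) → Pred Y 0ℓ → Pred Y 0ℓ
    improve b x with decide (Improvement b)
    ... | yes (y , _) = y
    ... | no  _       = x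

    next : Pred Y 0ℓ → Pred Y 0ℓ
    next x = improve (χ x) x

    next-≽ : ∀ x → x ≼ next x
    next-≽ x A a with decide (Improvement (χ x))
    ... | yes (_ , _ , x≼y , _) = x≼y A (pack a)
    ... | no _                  = a

    next-Φ : ∀ x → Φ x → Φ (next x)
    next-Φ x Φx with decide (Improvement (χ x))
    ... | yes (_ , Φy , _) = Φy
    ... | no _             = Φx

    -- An improvement is strict, so an `x` that `next` does not enlarge admits none.
    next-max : ∀ x → next x ≼ x → ∀ y → Φ y → x ≼ y → y ≼ x
    next-max x nx≼x y Φy x≼y with decide (Improvement (χ x))
    ... | yes (_ , _ , _ , ¬≼) = ⊥-elim (¬≼ λ A a → pack (nx≼x A a))
    ... | no ¬imp = byContradiction λ y⋠x →
      ¬imp (y , Φy , (λ A a → x≼y A (unpack a)) , λ y≼χ → y⋠x λ A a → unpack (y≼χ A a))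

    next-cong : ∀ {x y} → x ≼ y → y ≼ x → next x ≼ next y
    next-cong {x} {y} x≼y y≼x =
      subst (λ b → next x ≼ improve b y)
        (ext _ _ λ A → ⌊⌋-cong (x≼y A) (y≼x A)) (improve-mono (χ x))
      where
      improve-mono : ∀ b → improve b x ≼ improve b y
      improve-mono b A a with decide (Improvement b)
      ... | yes _ = a
      ... | no _  = x≼y A a

    -- A route to Zorn's lemma without ordinals: this family turns out to be a chain, so its union
    -- is fixed by `next`. Limits range over small predicates `C`, which keeps the universe level
    -- down.
    data Tower : Pred (Pred Y 0ℓ) (lsuc 0ℓ) where
      bottom : Tower base
      step   : ∀ {x} → Tower x → Tower (next x)
      lim    : (C : Pred (Pred Y 0ℓ) 0ℓ) → (∀ {x} → C x → Tower x) → ∃ C → Tower (⋃ C)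

    base-least : ∀ {x} → Tower x → base ≼ x
    base-least bottom              A a = a
    base-least (step {x} tx)       A a = next-≽ x A (base-least tx A a)
    base-least (lim C C⊆T (x , Cx)) A a = ⋃-upper Cx A (base-least (C⊆T Cx) A a)

    compare : ∀ {x y} → Tower x → Tower y → x ≼ y ⊎ next y ≼ x
    compare bottom ty = inj₁ (base-least ty)
    compare {y = y} (step {x} tx) ty with compare tx ty
    ... | inj₂ ny≼x = inj₂ λ A a → next-≽ x A (ny≼x A a)
    -- Comparing in the opposite order leaves either `next x ≼ y` or mutual inclusion of `x` and
    -- `y`; the latter is where `next-cong` is needed.
    ... | inj₁ x≼y with compare ty tx
    ...   | inj₂ nx≼y = inj₁ nx≼y
    ...   | inj₁ y≼x  = inj₂ (next-cong y≼x x≼y)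
    compare {y = y} (lim C C⊆T _) ty
      with decide (Σ[ x ∈ Pred Y 0ℓ ] C x × ¬ x ≼ y)
    ... | no none = inj₁ (⋃-least λ {x} Cx → byContradiction λ x⋠y → none (x , Cx , x⋠y))
    ... | yes (x , Cx , x⋠y) with compare (C⊆T Cx) ty
    ...   | inj₁ x≼y  = contradiction x≼y x⋠y
    ...   | inj₂ ny≼x = inj₂ λ A a → ⋃-upper Cx A (ny≼x A a)

    Tower-total : ∀ {x y} → Tower x → Tower y → x ≼ y ⊎ y ≼ x
    Tower-total {y = y} tx ty with compare tx ty
    ... | inj₁ x≼y  = inj₁ x≼y
    ... | inj₂ ny≼x = inj₂ λ A a → ny≼x A (next-≽ y A a)

    maximal :
      (∀ C → (∀ {x} → C x → Φ x) → Chain C → ∃ C → Φ (⋃ C)) →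
      Σ[ x ∈ Pred Y 0ℓ ] Φ x × base ≼ x × (∀ y → Φ y → x ≼ y → y ≼ x)
    maximal Φ-⋃ = top , Tower-Φ top∈T , base-least top∈T ,
      next-max top (⋃-upper (pack (step top∈T)))
      where
      Tower-Φ : ∀ {x} → Tower x → Φ x
      Tower-Φ bottom              = Φ-base
      Tower-Φ (step tx)           = next-Φ _ (Tower-Φ tx)
      Tower-Φ (lim C C⊆T nonempty) = Φ-⋃ C (λ Cx → Tower-Φ (C⊆T Cx))
        (λ Cx Cy → Tower-total (C⊆T Cx) (C⊆T Cy)) nonempty

      -- Resizing turns the whole tower into a family to which `lim` applies, so its union belongs
      -- to the tower.
      top : Pred Y 0ℓ
      top = ⋃ (λ x → Resize (Tower x))

      top∈T : Tower top
      top∈T = lim _ unpack (base , pack bottom)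

  -- Filters and ultrafilters

  Family : Set → Set₁
  Family X = Pred (Pred X 0ℓ) 0ℓ

  infix 4 _≼_

  _≼_ : ∀ {X} → Family X → Family X → Set₁
  φ ≼ ψ = ∀ A → φ A → ψ A

  record IsFilter {X : Set} (φ : Family X) : Set₁ where
    field
      ∋-U    : φ U
      ∌-∅    : ¬ φ ∅
      upward : ∀ {A B} → A ⊆ B → φ A → φ B
      ∋-∩    : ∀ {A B} → φ A → φ B → φ (A ∩ B)

    upward₂ : ∀ {A B C} → (∀ {x} → A x → B x → C x) → φ A → φ B → φ C
    upward₂ f a b = upward (λ (x , y) → f x y) (∋-∩ a b)

  open IsFilter

  ultrafilter-isFilter : ∀ {X} (u : Ultrafilter X) → IsFilter (u ∋_)
  ultrafilter-isFilter u = record { Ultrafilter u hiding (_∋_; ultra) }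

  ∌⇒∋∁ : ∀ {X} (u : Ultrafilter X) {A} → ¬ u ∋ A → u ∋ ∁ A
  ∌⇒∋∁ u {A} u∌A = [ (λ u∋A → contradiction u∋A u∌A) , id ] (Ultrafilter.ultra u A)

  ultra-≼-sym : ∀ {X} (u v : Ultrafilter X) → (u ∋_) ≼ (v ∋_) → (v ∋_) ≼ (u ∋_)
  ultra-≼-sym u v u≼v A v∋A with Ultrafilter.ultra u A
  ... | inj₁ u∋A = u∋A
  ... | inj₂ u∋∁A = ⊥-elim (∌-∅ fv (upward₂ fv (λ a ¬a → ¬a a) v∋A (u≼v _ u∋∁A)))
    where fv = ultrafilter-isFilter v

  -- The condition `φ ≼ op φ` passes to unions of chains because `op` is monotone. Constant `U`
  -- yields ultrafilters, `φ · φ` minimal closed subsemigroups, and `φ₀ · φ` minimal closed left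
  -- ideals.
  maximalFilter : ∀ {X} (op : Family X → Family X) →
    (∀ {φ ψ} → IsFilter ψ → φ ≼ ψ → op φ ≼ op ψ) →
    ∀ {φ₀} → IsFilter φ₀ → φ₀ ≼ op φ₀ →
    Σ[ φ ∈ Family X ] IsFilter φ × φ ≼ op φ × φ₀ ≼ φ ×
      (∀ {ψ} → IsFilter ψ → ψ ≼ op ψ → φ ≼ ψ → ψ ≼ φ)
  maximalFilter {X} op op-mono {φ₀} φ₀-filter φ₀≼ =
    let φ , (φ-filter , φ≼) , φ₀≼φ , φ-max = maximal ⋃-closed
    in φ , φ-filter , φ≼ , φ₀≼φ , λ ψ-filter ψ≼ → φ-max _ (ψ-filter , ψ≼)
    where
    open Hausdorff (λ φ → IsFilter φ × φ ≼ op φ) φ₀ (φ₀-filter , φ₀≼) hiding (_≼_)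

    ⋃-closed : ∀ C → (∀ {φ} → C φ → IsFilter φ × φ ≼ op φ) → Chain C → ∃ C →
      IsFilter (⋃ C) × ⋃ C ≼ op (⋃ C)
    ⋃-closed C C⊆Φ chain (φ , Cφ) = ⋃-filter , ⋃-least λ Cψ A a →
      op-mono ⋃-filter (⋃-upper Cψ) A (proj₂ (C⊆Φ Cψ) A a)
      where
      ⋃-filter : IsFilter (⋃ C)
      ⋃-filter .∋-U = pack (φ , Cφ , ∋-U (proj₁ (C⊆Φ Cφ)))
      ⋃-filter .∌-∅ e with _ , Cψ , ψ∅ ← unpack e = ∌-∅ (proj₁ (C⊆Φ Cψ)) ψ∅
      ⋃-filter .upward A⊆B a with ψ , Cψ , ψA ← unpack a =
        pack (ψ , Cψ , upward (proj₁ (C⊆Φ Cψ)) A⊆B ψA)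
      ⋃-filter .∋-∩ {A} {B} a b with ψ , Cψ , ψA ← unpack a | ω , Cω , ωB ← unpack b
        with chain Cψ Cω
      ... | inj₁ ψ≼ω = pack (ω , Cω , ∋-∩ (proj₁ (C⊆Φ Cω)) (ψ≼ω A ψA) ωB)
      ... | inj₂ ω≼ψ = pack (ψ , Cψ , ∋-∩ (proj₁ (C⊆Φ Cψ)) ψA (ω≼ψ B ωB))

  ultrafilterExtension : ∀ {X} {φ : Family X} → IsFilter φ → Σ[ u ∈ Ultrafilter X ] φ ≼ (u ∋_)
  ultrafilterExtension {X} φ-filter
    with φ , f , _ , φ₀≼φ , φ-max ← maximalFilter (λ _ → U) (λ _ _ _ _ → _) φ-filter (λ _ _ → _)
    = record { IsFilter f ; _∋_ = φ ; ultra = ultra φ f φ-max } , φ₀≼φ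
    where
    ultra : ∀ φ → IsFilter φ → (∀ {ψ} → IsFilter ψ → ψ ≼ U → φ ≼ ψ → ψ ≼ φ) →
      ∀ A → φ A ⊎ φ (∁ A)
    ultra φ f φ-max A with decide (φ (∁ A))
    ... | yes φ∁A = inj₂ φ∁A
    -- This is the filter generated by `φ` and `A`, proper because `∁ A` is not in `φ`; maximality
    -- puts `A` into `φ`.
    ... | no ¬φ∁A = inj₁ (φ-max {λ B → φ (λ x → A x → B x)}
      (record
        { ∋-U    = upward f (λ _ _ → _) (∋-U f)
        ; ∌-∅    = ¬φ∁A
        ; upward = λ B⊆C → upward f λ b a → B⊆C (b a)
        ; ∋-∩    = upward₂ f λ b c a → b a , c a
        })
      (λ _ _ → _) (λ B → upward f (λ b _ → b)) A (upward f (λ _ a → a) (∋-U f)))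

  -- Idempotent ultrafilters

  module Semigroup {X : Set} (_∙_ : X → X → X)
    (assoc : ∀ x y z → (x ∙ y) ∙ z ≡ x ∙ (y ∙ z)) where

    infixl 7 _·_

    _·_ : Family X → Family X → Family X
    (φ · ψ) A = φ λ x → ψ λ y → A (x ∙ y)

    reassoc : ∀ (A : Pred X 0ℓ) {x y z} → A ((x ∙ y) ∙ z) → A (x ∙ (y ∙ z))
    reassoc A = subst A (assoc _ _ _)

    reassoc⁻ : ∀ (A : Pred X 0ℓ) {x y z} → A (x ∙ (y ∙ z)) → A ((x ∙ y) ∙ z)
    reassoc⁻ A = subst A (sym (assoc _ _ _))

    ·-filter : ∀ {φ ψ} → IsFilter φ → IsFilter ψ → IsFilter (φ · ψ)
    ·-filter f g = record
      { ∋-U    = upward f (λ _ → ∋-U g) (∋-U f)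
      ; ∌-∅    = λ e → ∌-∅ f (upward f (λ e′ → ∌-∅ g e′) e)
      ; upward = λ A⊆B → upward f (upward g A⊆B)
      ; ∋-∩    = upward₂ f (∋-∩ g)
      }

    ·-monoʳ : ∀ {φ ψ χ} → IsFilter φ → ψ ≼ χ → φ · ψ ≼ φ · χ
    ·-monoʳ f ψ≼χ _ = upward f (ψ≼χ _)

    infixl 7 _⊗_

    _⊗_ : Ultrafilter X → Ultrafilter X → Ultrafilter X
    p ⊗ q = limit p q _∙_

    Idem : Ultrafilter X → Set₁
    Idem p = p ⊗ p ≈ᵤ p

    Idem-≼ : ∀ p → (p ∋_) ≼ (p ⊗ p ∋_) → Idem p
    Idem-≼ p p≼pp A = mk⇔ (ultra-≼-sym p (p ⊗ p) p≼pp A) (p≼pp A)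

    -- Up to associativity the right side is `φ · (χ · φ) · χ`: the left factor `φ` is doubled, then
    -- its second copy is replaced by `χ · φ`.
    ·-square : ∀ {φ χ} → IsFilter φ → IsFilter χ → φ ≼ φ · φ → φ ≼ χ · φ →
      φ · χ ≼ (φ · χ) · (φ · χ)
    ·-square f g φ≼φφ φ≼χφ A a =
      upward f (λ b → upward g (λ c → upward f (upward g (reassoc A ∘ reassoc⁻ (λ z → A (z ∙ _)))) c)
        (φ≼χφ _ b)) (φ≼φφ _ a)

    -- If some A in e had {x : x⁻¹A ∈ r} outside e, then the elements x of A
    -- with x⁻¹A ∉ r would form a set B in e with x⁻¹B ∈ r for no x.
    absorbʳ : ∀ {φ} → IsFilter φ → ∀ r e → Idem r → φ · (r ∋_) ≼ (e ∋_) →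
      (e ∋_) ≼ (e ∋_) · (r ∋_)
    absorbʳ f r e r-idem φr≼e A e∋A
      with Ultrafilter.ultra e (λ x → r ∋ λ y → A (x ∙ y))
    ... | inj₁ d = d
    ... | inj₂ ¬d = ⊥-elim (∌-∅ e-filter (upward₂ e-filter (λ b ¬b → ¬b b)
        (∋-∩ e-filter e∋A e∋D) (φr≼e (∁ (A ∩ D)) (upward f (λ {x} _ → ∁B x) (∋-U f)))))
      where
      r-filter = ultrafilter-isFilter r
      e-filter = ultrafilter-isFilter e

      D : Pred X 0ℓ
      D x = r ∋ λ y → ¬ A (x ∙ y)

      e∋D : e ∋ D
      e∋D = upward e-filter (∌⇒∋∁ r) ¬d

      ∁B : ∀ x → r ∋ λ y → ¬ (A ∩ D) (x ∙ y)
      ∁B x = ∌⇒∋∁ r λ r∋B → ∌-∅ r-filter (upward₂ r-filter (λ (a , _) ¬a → ¬a a) r∋B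
        (Equivalence.to (r-idem (λ y → ¬ A (x ∙ y)))
          (upward r-filter (λ (_ , d) → upward r-filter (reassoc (∁ A)) d) r∋B)))

    -- Papazyan's argument: for a maximal filter φ ⊆ φ·φ and an ultrafilter
    -- p ⊇ φ, maximality gives φ·p = φ, then that φ contains all the sets
    -- {x : x⁻¹A ∈ p} with A ∈ p.
    idempotentExtension : ∀ {φ₀} → IsFilter φ₀ → φ₀ ≼ φ₀ · φ₀ →
      Σ[ p ∈ Ultrafilter X ] Idem p × φ₀ ≼ (p ∋_)
    idempotentExtension {φ₀} f₀ φ₀≼ =
      let φ , f , φ≼ , φ₀≼φ , φ-max = maximalFilter (λ φ → φ · φ) square-mono f₀ φ₀≼
          p , φ≼p = ultrafilterExtension f
      in p , Idem-≼ p (λ A p∋A → φ≼p _ (absorb f φ≼ φ-max p φ≼p A p∋A)) ,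
         λ A a → φ≼p A (φ₀≼φ A a)
      where
      square-mono : ∀ {φ ψ} → IsFilter ψ → φ ≼ ψ → φ · φ ≼ ψ · ψ
      square-mono g φ≼ψ A a = upward g (φ≼ψ _) (φ≼ψ _ a)

      absorb : ∀ {φ} → IsFilter φ → φ ≼ φ · φ →
        (∀ {ψ} → IsFilter ψ → ψ ≼ ψ · ψ → φ ≼ ψ → ψ ≼ φ) →
        ∀ p → φ ≼ (p ∋_) → (p ∋_) ≼ φ · (p ∋_)
      absorb {φ} f φ≼ φ-max p φ≼p A p∋A =
        φ-max ψ-filter ψ-square (λ B b → pack (U , ∋-U p-filter , upward f (λ x _ → x) b)) _
          (pack (A , p∋A , upward f (λ _ x → x) (∋-U f)))
        where
        p-filter = ultrafilter-isFilter p

        -- `φ · p` is a filter closed in the same sense and contains `φ`, so maximality applies.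
        φp≼φ : φ · (p ∋_) ≼ φ
        φp≼φ = φ-max (·-filter f p-filter)
          (·-square f p-filter φ≼ λ A a → φ≼p _ (φ≼ A a))
          (λ A a → upward f (φ≼p _) (φ≼ A a))

        D : Pred X 0ℓ → Pred X 0ℓ
        D A x = p ∋ λ y → A (x ∙ y)

        -- The filter generated by `φ` and the sets `D A` with `p ∋ A`. It is proper: if `φ`
        -- contained the complement of `D A`, then `∁ A` would lie in `φ · p`, hence in `φ` and in
        -- `p`.
        ψ : Family X
        ψ B = Resize (Σ[ A ∈ Pred X 0ℓ ] p ∋ A × φ λ x → D A x → B x)

        ψ-filter : IsFilter ψ
        ψ-filter .∋-U = pack (U , ∋-U p-filter , upward f _ (∋-U f))
        ψ-filter .∌-∅ e with A , p∋A , a ← unpack e =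
          ∌-∅ p-filter (upward₂ p-filter (λ a ¬a → ¬a a) p∋A (φ≼p _ (φp≼φ (∁ A)
            (upward f (∌⇒∋∁ p) a))))
        ψ-filter .upward B⊆C b with A , p∋A , a ← unpack b =
          pack (A , p∋A , upward f (λ g d → B⊆C (g d)) a)
        ψ-filter .∋-∩ b c with A , p∋A , a ← unpack b | A′ , p∋A′ , a′ ← unpack c =
          pack (A ∩ A′ , ∋-∩ p-filter p∋A p∋A′ ,
            upward₂ f (λ g h d → g (upward p-filter proj₁ d) , h (upward p-filter proj₂ d)) a a′)

        ψ-square : ψ ≼ ψ · ψ
        ψ-square B b with A , p∋A , a ← unpack b =
          -- For `x` in `D A`, the quotient of `A` by `x` lies in `p` and is the witness for the
          -- inner membership.
          pack (A , p∋A , upward f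
            (λ {x} g d → pack ((λ y → A (x ∙ y)) , d ,
              upward f (λ k d′ → k (upward p-filter (reassoc⁻ A) d′)) g))
            (φ≼ _ a))

    -- Inclusions of ultrafilters are equalities: r·p = r implies p·r = p.
    RightMinimal : Family X → Ultrafilter X → Set₁
    RightMinimal φ p = ∀ r → Idem r → φ ≼ (r ∋_) → (r ⊗ p ∋_) ≼ (r ∋_) → (p ∋_) ≼ (p ⊗ r ∋_)

    -- A maximal filter ψ ⊆ φ₀·ψ stands for a minimal closed left ideal.
    minimalIdempotent : ∀ {φ₀} → IsFilter φ₀ → φ₀ ≼ φ₀ · φ₀ →
      Σ[ p ∈ Ultrafilter X ] Idem p × φ₀ ≼ (p ∋_) × RightMinimal φ₀ p
    minimalIdempotent {φ₀} f₀ φ₀≼ =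
      let ψ , g , ψ≼ , φ₀≼ψ , ψ-max = maximalFilter (φ₀ ·_) (λ _ → ·-monoʳ f₀) f₀ φ₀≼
          p , p-idem , ψ≼p = idempotentExtension g λ A a → φ₀≼ψ _ (ψ≼ A a)
      in p , p-idem , (λ A a → ψ≼p A (φ₀≼ψ A a)) , λ r r-idem φ₀≼r rp≼r →
         let r-filter = ultrafilter-isFilter r
             ψ≼r : ψ ≼ (r ∋_)
             ψ≼r A a = rp≼r A (upward r-filter (ψ≼p _) (φ₀≼r _ (ψ≼ A a)))
         -- `φ₀ · r` stands for a closed left ideal inside that of `ψ`, so by maximality it is
         -- contained in `ψ` and hence in `p`.
         in absorbʳ f₀ r p r-idem λ A a → ψ≼p A (ψ-max (·-filter f₀ r-filter)
              (λ A a → upward f₀ (upward f₀ (upward r-filter (reassoc A))) (φ₀≼ _ a))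
              (λ A a → upward f₀ (ψ≼r _) (ψ≼ A a)) A a)

  ⋂ : ∀ {ℓ} {I : Set ℓ} {X : Set} → (I → Pred X 0ℓ) → List I → Pred X 0ℓ
  ⋂ B = foldr (λ i A → B i ∩ A) U

  ⋂-∋ : ∀ {ℓ} {I : Set ℓ} {X} {φ : Family X} → IsFilter φ → (B : I → Pred X 0ℓ) →
    ∀ is → (∀ {i} → i ∈ₗ is → φ (B i)) → φ (⋂ B is)
  ⋂-∋ f B []       φ∋B = ∋-U f
  ⋂-∋ f B (i ∷ is) φ∋B = ∋-∩ f (φ∋B (here refl)) (⋂-∋ f B is (φ∋B ∘ there))

  ⋂-lower : ∀ {ℓ} {I : Set ℓ} {X : Set} (B : I → Pred X 0ℓ) {i is} →
    i ∈ₗ is → ⋂ B is ⊆ B i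
  ⋂-lower B (here refl) (b , _) = b
  ⋂-lower B (there i∈)  (_ , m) = ⋂-lower B i∈ m

  value-injective : ∀ {x y} → value x ≡ value y → x ≡ y
  value-injective refl = refl

  +-assoc⁺ : ∀ x y z → (x + y) + z ≡ x + (y + z)
  +-assoc⁺ x y z = value-injective (ℕ.+-assoc (value x) (value y) (value z))

  -- Finite sets

  ⟦_⟧ : ∀ {X : Set} → 𝒫f X → List X
  ⟦ F ⟧ = List⁺.toList (elements F)

  infix 4 _≟_
  _≟_ : ∀ {X : Set} (x y : X) → Dec (x ≡ y)
  x ≟ y = decide (x ≡ y)

  -- Deduplication keeps the first entry, so the head stays `x`; the type of `deduplicate-!`
  -- determines the omitted tail.
  fromList : ∀ {X : Set} → X → List X → 𝒫f X
  fromList x xs .elements = List⁺._∷_ x _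
  fromList x xs .𝒫f.distinct = deduplicate-! _≟_ (x ∷ xs)

  ∈-fromList⁺ : ∀ {X : Set} (x : X) xs {y} → y ∈ₗ x ∷ xs → y ∈f fromList x xs
  ∈-fromList⁺ x xs = ∈-deduplicate⁺ _≟_

  some : ∀ {X : Set} → 𝒫f X → X
  some F = List⁺.head (elements F)

  some∈ : ∀ {X : Set} (F : 𝒫f X) → some F ∈f F
  some∈ F = here refl

  infixr 6 _∪f_
  _∪f_ : ∀ {X : Set} → 𝒫f X → 𝒫f X → 𝒫f X
  F ∪f G = fromList (some F) (List⁺.tail (elements F) ++ ⟦ G ⟧)

  ⊆-∪ˡ : ∀ {X : Set} (F G : 𝒫f X) → F ⊆f F ∪f G
  ⊆-∪ˡ F G = ∈-fromList⁺ _ _ ∘ ∈-++⁺ˡ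

  ⊆-∪ʳ : ∀ {X : Set} (F G : 𝒫f X) → G ⊆f F ∪f G
  ⊆-∪ʳ F G = ∈-fromList⁺ _ _ ∘ ∈-++⁺ʳ ⟦ F ⟧

  ⊆-⊊-trans : ∀ {X : Set} (F G K : 𝒫f X) → F ⊆f G → G ⊊f K → F ⊊f K
  ⊆-⊊-trans F G K F⊆G (G⊆K , G≉K) = (λ x → G⊆K (F⊆G x)) ,
    λ (_ , K⊆F) → G≉K (G⊆K , λ x → F⊆G (K⊆F x))

  value-∑ : ∀ {X : Set} (F : 𝒫f X) g → value (∑ F g) ≡ sum (List.map (value ∘ g) ⟦ F ⟧)
  value-∑ F g = go (some F) (List⁺.tail (elements F))
    where
    go : ∀ x xs → value (List⁺.foldr₁ _+_ (List⁺.map g (List⁺._∷_ x xs))) ≡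
      sum (List.map (value ∘ g) (x ∷ xs))
    go x []       = sym (ℕ.+-identityʳ _)
    go x (y ∷ xs) = cong (value (g x) ℕ.+_) (go y xs)

  ∈⇒≤sum : ∀ {X : Set} (g : X → ℕ) {x xs} → x ∈ₗ xs → g x ≤ sum (List.map g xs)
  ∈⇒≤sum g (here refl) = ℕ.m≤m+n _ _
  ∈⇒≤sum g (there x∈)  = ℕ.≤-trans (∈⇒≤sum g x∈) (ℕ.m≤n+m _ _)

  ∈⇒≤max : ∀ (β : 𝒫f ℕ⁺) {i} → i ∈f β → value i ≤ max β
  ∈⇒≤max β = go (some β) (List⁺.tail (elements β))
    where
    go : ∀ x xs {i} → i ∈ₗ x ∷ xs → value i ≤ List⁺.foldr₁ ℕ._⊔_ (List⁺.map value (List⁺._∷_ x xs))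
    go x []       (here refl) = ℕ.≤-refl
    go x (y ∷ xs) (here refl) = ℕ.m≤m⊔n _ _
    go x (y ∷ xs) (there i∈)  = ℕ.≤-trans (go y xs i∈) (ℕ.m≤n⊔m _ _)

  ∈⇒min≤ : ∀ (β : 𝒫f ℕ⁺) {i} → i ∈f β → min β ≤ value i
  ∈⇒min≤ β = go (some β) (List⁺.tail (elements β))
    where
    go : ∀ x xs {i} → i ∈ₗ x ∷ xs → List⁺.foldr₁ ℕ._⊓_ (List⁺.map value (List⁺._∷_ x xs)) ≤ value i
    go x []       (here refl) = ℕ.≤-refl
    go x (y ∷ xs) (here refl) = ℕ.m⊓n≤m _ _
    go x (y ∷ xs) (there i∈)  = ℕ.≤-trans (ℕ.m⊓n≤n _ _) (go y xs i∈)

  disjointUnion : ∀ {X : Set} (β γ : 𝒫f X) → (∀ x → x ∈f β → ¬ x ∈f γ) → 𝒫f X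
  disjointUnion β γ disjoint .elements = elements β List⁺.⁺++ ⟦ γ ⟧
  disjointUnion β γ disjoint .𝒫f.distinct =
    Unique.++⁺ (𝒫f.distinct β) (𝒫f.distinct γ) λ (x∈β , x∈γ) → disjoint _ x∈β x∈γ

  ∑-disjointUnion : ∀ {X : Set} (β γ : 𝒫f X) disjoint g →
    ∑ (disjointUnion β γ disjoint) g ≡ ∑ β g + ∑ γ g
  ∑-disjointUnion β γ disjoint g = value-injective (begin
    value (∑ (disjointUnion β γ disjoint) g)
      ≡⟨ value-∑ (disjointUnion β γ disjoint) g ⟩
    sum (List.map g′ (⟦ β ⟧ ++ ⟦ γ ⟧))
      ≡⟨ cong sum (map-++ g′ ⟦ β ⟧ ⟦ γ ⟧) ⟩
    sum (List.map g′ ⟦ β ⟧ ++ List.map g′ ⟦ γ ⟧)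
      ≡⟨ sum-++ (List.map g′ ⟦ β ⟧) (List.map g′ ⟦ γ ⟧) ⟩
    sum (List.map g′ ⟦ β ⟧) ℕ.+ sum (List.map g′ ⟦ γ ⟧)
      ≡⟨ cong₂ ℕ._+_ (value-∑ β g) (value-∑ γ g) ⟨
    value (∑ β g) ℕ.+ value (∑ γ g) ∎)
    where
    open ≡-Reasoning
    g′ = value ∘ g

  one⁺ : ℕ⁺
  one⁺ = mkℕ⁺ 1

  -- A function above the sum of all members of `F` differs from each of them already at 1.
  freshFunction : (F : 𝒫f Fun) → Σ[ f ∈ Fun ] ¬ f ∈f F
  freshFunction F = f , λ f∈F → ℕ.<-irrefl refl (begin-strict
    value (f one⁺)                              ≤⟨ ∈⇒≤sum (λ g → value (g one⁺)) f∈F ⟩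
    sum (List.map (λ g → value (g one⁺)) ⟦ F ⟧) ≡⟨ value-∑ F _ ⟨
    value (∑ F (λ g → g one⁺))                  <⟨ ℕ.n<1+n _ ⟩
    value (f one⁺)                              ∎)
    where
    open ℕ.≤-Reasoning

    f : Fun
    f t = suc⁺ (∑ F (λ g → g t))

  enlarge : (F : 𝒫f Fun) → Σ[ G ∈ 𝒫f Fun ] F ⊊f G
  enlarge F with f , f∉F ← freshFunction F =
    fromList f ⟦ F ⟧ , (∈-fromList⁺ f ⟦ F ⟧ ∘ there) ,
    λ (_ , G⊆F) → f∉F (G⊆F (∈-fromList⁺ f ⟦ F ⟧ (here refl)))

  -- Chain sums and the minimal idempotent

  -- The indices are a start and an end, so that an element from `F` to `G` can be followed by one
  -- from `G` to `K`.
  Graded : Set → Set₁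
  Graded X = 𝒫f Fun → 𝒫f Fun → Pred X 0ℓ

  generated : ∀ {X} → Graded X → Family X
  generated K A = Σ[ F ∈ 𝒫f Fun ] (∀ {G x} → K F G x → A x)

  generated-filter : ∀ {X} {K : Graded X} →
    (∀ F → Σ[ G ∈ 𝒫f Fun ] ∃ (K F G)) →
    (∀ {F F′ G x} → F ⊆f F′ → K F′ G x → K F G x) →
    IsFilter (generated K)
  generated-filter inhabited weaken = record
    { ∋-U    = fromList (const one⁺) [] , _
    ; ∌-∅    = λ (F , K⊆∅) → K⊆∅ (proj₂ (proj₂ (inhabited F)))
    ; upward = λ A⊆B (F , K⊆A) → F , λ k → A⊆B (K⊆A k)
    ; ∋-∩    = λ (F , K⊆A) (F′ , K⊆B) → F ∪f F′ ,
        λ k → K⊆A (weaken (⊆-∪ˡ F F′) k) , K⊆B (weaken (⊆-∪ʳ F F′) k)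
    }

  module Chains (α : 𝒫f Fun → ℕ⁺) (H : 𝒫f Fun → 𝒫f ℕ⁺)
    (H-increasing : ∀ F G → F ⊊f G → max (H F) < min (H G)) where

    term : 𝒫f Fun → Fun → ℕ⁺
    term G f = α G + ∑ (H G) f

    data Chain (F : 𝒫f Fun) : 𝒫f Fun → Pred ℕ⁺ 0ℓ where
      one  : ∀ {G f} → F ⊊f G → f ∈f G → Chain F G (term G f)
      more : ∀ {G G′ f x} → F ⊊f G → f ∈f G → Chain G G′ x → Chain F G′ (term G f + x)

    chain-⊆ : ∀ {F G x} → Chain F G x → F ⊆f G
    chain-⊆ (one F⊊G _)    f∈ = proj₁ F⊊G f∈
    chain-⊆ (more F⊊G _ c) f∈ = chain-⊆ c (proj₁ F⊊G f∈)

    chain-weaken : ∀ {F F′ G x} → F ⊆f F′ → Chain F′ G x → Chain F G x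
    chain-weaken {F} {F′} F⊆F′ (one {G} F′⊊G g∈G)    = one (⊆-⊊-trans F F′ G F⊆F′ F′⊊G) g∈G
    chain-weaken {F} {F′} F⊆F′ (more {G} F′⊊G g∈G c) = more (⊆-⊊-trans F F′ G F⊆F′ F′⊊G) g∈G c

    chain-++ : ∀ {F G K x y} → Chain F G x → Chain G K y → Chain F K (x + y)
    chain-++ (one F⊊G g∈G) d = more F⊊G g∈G d
    chain-++ {F} {K = K} {y = y} (more {G} {f = g} {x} F⊊G g∈G c) d =
      subst (Chain F K) (sym (+-assoc⁺ (term G g) x y)) (more F⊊G g∈G (chain-++ c d))

    chain-inhabited : ∀ F → Σ[ G ∈ 𝒫f Fun ] ∃ (Chain F G)
    chain-inhabited F with G , F⊊G ← enlarge F = G , _ , one F⊊G (some∈ G)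

    module ℕ⁺-semigroup = Semigroup _+_ +-assoc⁺

    chainSums : Family ℕ⁺
    chainSums = generated Chain

    chainSums-filter : IsFilter chainSums
    chainSums-filter = generated-filter chain-inhabited chain-weaken

    chainSums-square : chainSums ≼ chainSums ℕ⁺-semigroup.· chainSums
    chainSums-square A (F , C⊆A) = F , λ {G} c → G , λ d → C⊆A (chain-++ c d)

    -- Words with a variable

    M : Set
    M = Fun → ℕ⁺

    infixl 6 _⊹_
    _⊹_ : M → M → M
    (z ⊹ w) f = z f + w f

    ⊹-assoc : ∀ x y z → (x ⊹ y) ⊹ z ≡ x ⊹ (y ⊹ z)
    ⊹-assoc x y z = ext _ _ λ f → +-assoc⁺ (x f) (y f) (z f)

    Constant : Pred M 0ℓ
    Constant z = Σ[ a ∈ ℕ⁺ ] (∀ f → z f ≡ a)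

    -- The indices in all `H K` with `K ⊆f G`; a variable word ending at `G` takes its indices from
    -- here.
    record Reached (G : 𝒫f Fun) (j : ℕ⁺) : Set where
      constructor reached
      field
        {by} : 𝒫f Fun
        by⊆G : by ⊆f G
        j∈H  : j ∈f H by

    reached-weaken : ∀ F G → F ⊆f G → Reached F ⊆ Reached G
    reached-weaken F G F⊆G (reached K⊆F j∈H) = reached (λ x → F⊆G (K⊆F x)) j∈H

    -- The bounds keep the index sets of consecutive words disjoint.
    record Variable (F G : 𝒫f Fun) (z : M) : Set where
      constructor var
      field
        shift    : ℕ⁺
        indices  : 𝒫f ℕ⁺
        equation : ∀ f → z f ≡ shift + ∑ indices f
        lower    : ∀ {i j} → Reached F i → j ∈f indices → value i < value j
        upper    : ∀ {j} → j ∈f indices → Reached G j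

    variable-weaken : ∀ {F F′ G z} → F ⊆f F′ → Variable F′ G z → Variable F G z
    variable-weaken {F} {F′} F⊆F′ (var a β z≡ lower upper) =
      var a β z≡ (λ r → lower (reached-weaken F F′ F⊆F′ r)) upper

    constant-variable : ∀ {F G K z w} → F ⊆f G → Constant z → Variable G K w → Variable F K (z ⊹ w)
    constant-variable F⊆G (a , z≡) v with var b β w≡ lower upper ← variable-weaken F⊆G v =
      var (a + b) β (λ f → trans (cong₂ _+_ (z≡ f) (w≡ f)) (sym (+-assoc⁺ a b (∑ β f)))) lower upper

    variable-constant : ∀ {F G K z w} → G ⊆f K → Variable F G z → Constant w → Variable F K (z ⊹ w)
    variable-constant {G = G} {K} G⊆K (var a β z≡ lower upper) (b , w≡) = var (a + b) β
      (λ f → trans (cong₂ _+_ (z≡ f) (w≡ f)) (value-injective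
        (xy∙z≈xz∙y ℕ.+-commutativeSemigroup (value a) (value (∑ β f)) (value b))))
      lower (λ j∈ → reached-weaken G K G⊆K (upper j∈))

    variable-variable : ∀ {F G K z w} → F ⊆f G → G ⊆f K →
      Variable F G z → Variable G K w → Variable F K (z ⊹ w)
    variable-variable {F} {G} {K} F⊆G G⊆K (var a β z≡ lower upper) (var b γ w≡ lower′ upper′) =
      var (a + b) (disjointUnion β γ disjoint)
        (λ f → trans (cong₂ _+_ (z≡ f) (w≡ f)) (trans
          (value-injective (interchange ℕ.+-commutativeSemigroup
            (value a) (value (∑ β f)) (value b) (value (∑ γ f))))
          (cong ((a + b) +_) (sym (∑-disjointUnion β γ disjoint f)))))
        (λ r j∈ → [ lower r , lower′ (reached-weaken F G F⊆G r) ] (∈-++⁻ ⟦ β ⟧ j∈))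
        (λ j∈ → [ (λ j∈β → reached-weaken G K G⊆K (upper j∈β)) , upper′ ] (∈-++⁻ ⟦ β ⟧ j∈))
      where
      disjoint : ∀ j → j ∈f β → ¬ j ∈f γ
      disjoint _ j∈β j∈γ = ℕ.<-irrefl refl (lower′ (upper j∈β) j∈γ)

    -- Words over F₀, regarded as functions of the letter that is substituted
    -- for the variable.
    module Words (F₀ : 𝒫f Fun) where

      record Word (S : Graded M) (F G : 𝒫f Fun) (z : M) : Set where
        constructor word
        field
          increasing   : F ⊆f G
          substitution : ∀ {f} → f ∈f F₀ → Chain F G (z f)
          sort         : S F G z

      AnyWord VariableWord : Graded M
      AnyWord      = Word λ F G z → Constant z ⊎ Variable F G z
      VariableWord = Word Variable

      word-weaken : ∀ {S : Graded M} → (∀ {F F′ G z} → F ⊆f F′ → S F′ G z → S F G z) →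
        ∀ {F F′ G z} → F ⊆f F′ → Word S F′ G z → Word S F G z
      word-weaken S-weaken F⊆F′ (word F′⊆G cs s) =
        word (λ x → F′⊆G (F⊆F′ x)) (λ f∈ → chain-weaken F⊆F′ (cs f∈)) (S-weaken F⊆F′ s)

      variableWord-inhabited : ∀ F → Σ[ G ∈ 𝒫f Fun ] ∃ (VariableWord F G)
      -- Adjoining `F₀` makes every `f ∈f F₀` a legitimate choice from `G`, so a single term with
      -- its letter left open is a variable word.
      variableWord-inhabited F with G , F∪F₀⊊G ← enlarge (F ∪f F₀) =
        G , term G , word (proj₁ F⊊G) (λ f∈ → one F⊊G (proj₁ F∪F₀⊊G (⊆-∪ʳ F F₀ f∈)))
          (var (α G) (H G) (λ _ → refl) lower (reached id))
        where
        F⊊G : F ⊊f G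
        F⊊G = ⊆-⊊-trans F (F ∪f F₀) G (⊆-∪ˡ F F₀) F∪F₀⊊G

        lower : ∀ {i j} → Reached F i → j ∈f H G → value i < value j
        lower (reached {K} K⊆F i∈) j∈ = ℕ.≤-<-trans (∈⇒≤max (H K) i∈)
          (ℕ.<-≤-trans (H-increasing K G (⊆-⊊-trans K F G K⊆F F⊊G)) (∈⇒min≤ (H G) j∈))

      word-++ : ∀ {S S′ S″ : Graded M} →
        (∀ {F G K z w} → F ⊆f G → G ⊆f K → S F G z → S′ G K w → S″ F K (z ⊹ w)) →
        ∀ {F G K z w} → Word S F G z → Word S′ G K w → Word S″ F K (z ⊹ w)
      word-++ S-++ (word F⊆G cs s) (word G⊆K ds s′) = word (λ x → G⊆K (F⊆G x))
        (λ f∈ → chain-++ (cs f∈) (ds f∈)) (S-++ F⊆G G⊆K s s′)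

      any-variable : ∀ {F G K z w} → AnyWord F G z → VariableWord G K w → VariableWord F K (z ⊹ w)
      any-variable = word-++ λ F⊆G G⊆K c d →
        [ (λ c → constant-variable F⊆G c d) , (λ c → variable-variable F⊆G G⊆K c d) ] c

      variable-any : ∀ {F G K z w} → VariableWord F G z → AnyWord G K w → VariableWord F K (z ⊹ w)
      variable-any = word-++ λ F⊆G G⊆K c →
        [ variable-constant G⊆K c , variable-variable F⊆G G⊆K c ]

      words variableWords : Family M
      words         = generated AnyWord
      variableWords = generated VariableWord

      variableWords-filter : IsFilter variableWords
      variableWords-filter = generated-filter variableWord-inhabited (word-weaken variable-weaken)

      open Semigroup _⊹_ ⊹-assoc

      -- With `variableWords-≼ʳ`: variable words form a two-sided ideal among all words.
      variableWords-≼ˡ : variableWords ≼ words · variableWords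
      variableWords-≼ˡ A (F , V⊆A) = F , λ {G} c → G , λ d → V⊆A (any-variable c d)

      variableWords-≼ʳ : variableWords ≼ variableWords · words
      variableWords-≼ʳ A (F , V⊆A) = F , λ {G} c → G , λ d → V⊆A (variable-any c d)

      words-≼ : words ≼ variableWords
      words-≼ A (F , W⊆A) = F , λ (word F⊆G cs v) → W⊆A (word F⊆G cs (inj₂ v))

      variableWords-square : variableWords ≼ variableWords · variableWords
      variableWords-square A a = upward variableWords-filter (words-≼ _) (variableWords-≼ʳ A a)

      -- With P the image of the minimal idempotent p under constants, an
      -- idempotent e ⊇ variableWords·P satisfies e = e·P; evaluation at f ∈ F₀
      -- sends e to an idempotent r with r = r·p, so p = p·r by minimality,
      -- i.e. evaluation sends P·e to p.
      evaluationsToMinimal : ∀ p → Idempotent p → chainSums ≼ (p ∋_) →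
        ℕ⁺-semigroup.RightMinimal chainSums p → Σ[ q ∈ Ultrafilter M ] variableWords ≼ (q ∋_) ×
        (∀ {f} → f ∈f F₀ → ∀ {A} → p ∋ A → q ∋ λ z → A (z f))
      evaluationsToMinimal p p-idem chains≼p p-min =
        let e , e-idem , VP≼e = idempotentExtension (·-filter V-filter P-filter)
              (·-square V-filter P-filter variableWords-square
                λ A a → words≼P _ (variableWords-≼ˡ A a))
            V≼e : variableWords ≼ (e ∋_)
            V≼e A a = VP≼e A (upward V-filter (words≼P _) (variableWords-≼ʳ A a))
            e≼eP = absorbʳ V-filter P e (λ A → p-idem (λ x → A (const x))) VP≼e
        in P ⊗ e ,
           (λ A a → upward P-filter {A = λ z → variableWords λ w → A (z ⊹ w)} (V≼e _)
             (words≼P _ (variableWords-≼ˡ A a))) ,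
           λ {f} f∈ {A} → p-min (extension (λ z → z f) e) (λ A → e-idem (λ z → A (z f)))
             (λ A (F , C⊆A) → V≼e _ (F , λ (word _ cs _) → C⊆A (cs f∈)))
             (λ A → ultra-≼-sym e (e ⊗ P) e≼eP (λ z → A (z f))) A
        where
        V-filter = variableWords-filter

        P : Ultrafilter M
        P = extension const p

        P-filter = ultrafilter-isFilter P

        words≼P : words ≼ (P ∋_)
        words≼P A (F , W⊆A) = chains≼p _
          (F , λ c → W⊆A (word (chain-⊆ c) (λ _ → c) (inj₁ (_ , λ _ → refl))))

    minimal-𝒥 : ∀ p → Idempotent p → chainSums ≼ (p ∋_) →
      ℕ⁺-semigroup.RightMinimal chainSums p → p ∈ 𝒥
    minimal-𝒥 p p-idem chains≼p p-min A p∋A F₀ =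
      let q , V≼q , q∋A = evaluationsToMinimal p p-idem chains≼p p-min
          q-filter = ultrafilter-isFilter q
      -- The required word is found in an intersection of finitely many members of `q`, which cannot
      -- be empty.
      in byContradiction λ none → ∌-∅ q-filter (upward₂ q-filter
        {A = IsVariableWord} {⋂ (λ f z → A (z f)) ⟦ F₀ ⟧} {∅}
        (λ (_ , word _ _ (var a β z≡ _ _)) all∈A → none (a , β , λ f f∈ →
          subst A (z≡ f) (⋂-lower (λ f z → A (z f)) f∈ all∈A)))
        (V≼q IsVariableWord (_ , λ {G} v → G , v))
        (⋂-∋ q-filter (λ f z → A (z f)) ⟦ F₀ ⟧ λ f∈ → q∋A f∈ p∋A))
      where
      open Words F₀

      IsVariableWord : Pred M 0ℓ
      IsVariableWord z = ∃ λ G → VariableWord (fromList (const one⁺) []) G z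

    chainSums-idempotent : Σ[ p ∈ Ultrafilter ℕ⁺ ] p ∈ 𝒥 × Idempotent p × chainSums ≼ (p ∋_)
    chainSums-idempotent =
      let p , p-idem , chains≼p , p-min =
            ℕ⁺-semigroup.minimalIdempotent chainSums-filter chainSums-square
      in p , minimal-𝒥 p p-idem chains≼p p-min , p-idem , chains≼p

  -- Tensor powers and block sums

  -- ⨂ splits off the last coordinate, Tensor the first.
  Tensor : Ultrafilter ℕ⁺ → ∀ k → Pred (Vec ℕ⁺ k) 0ℓ → Set
  Tensor p zero    A = A []
  Tensor p (suc k) A = p ∋ λ x → Tensor p k λ v → A (x ∷ v)

  -- Associativity of the tensor product, by induction from the first coordinate.
  tensor-∷ʳ : ∀ p k A → Tensor p (suc k) A ⇔ Tensor p k (λ v → p ∋ λ x → A (v ∷ʳ x))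
  tensor-∷ʳ p zero    A = mk⇔ id id
  tensor-∷ʳ p (suc k) A = mk⇔
    (Ultrafilter.upward p λ {x} → Equivalence.to (tensor-∷ʳ p k λ v → A (x ∷ v)))
    (Ultrafilter.upward p λ {x} → Equivalence.from (tensor-∷ʳ p k λ v → A (x ∷ v)))

  ⨂⇔tensor : ∀ p k A → ⨂ (suc k) (const p) ∋ A ⇔ Tensor p (suc k) A
  ⨂⇔tensor p zero    A = mk⇔ id id
  ⨂⇔tensor p (suc k) A = mk⇔
    (λ t → Equivalence.from (tensor-∷ʳ p (suc k) A) (Equivalence.to (⨂⇔tensor p k B) t))
    (λ t → Equivalence.from (⨂⇔tensor p k B) (Equivalence.to (tensor-∷ʳ p (suc k) A) t))
    where
    B : Pred (Vec ℕ⁺ (suc k)) 0ℓ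
    B v = p ∋ λ x → A (v ∷ʳ x)

  max∈ : (β : 𝒫f ℕ⁺) → Σ[ i ∈ ℕ⁺ ] i ∈f β × value i ≡ max β
  max∈ β = go (some β) (List⁺.tail (elements β))
    where
    go : ∀ x xs → Σ[ i ∈ ℕ⁺ ] i ∈ₗ x ∷ xs × value i ≡ List⁺.foldr₁ ℕ._⊔_ (List⁺.map value (List⁺._∷_ x xs))
    go x []       = x , here refl , refl
    go x (y ∷ xs) with ℕ.⊔-sel (value x) (List⁺.foldr₁ ℕ._⊔_ (List⁺.map value (List⁺._∷_ y xs)))
    ... | inj₁ ≡x = x , here refl , sym ≡x
    ... | inj₂ ≡r with i , i∈ , ≡max ← go y xs = i , there i∈ , trans ≡max (sym ≡r)

  min∈ : (β : 𝒫f ℕ⁺) → Σ[ i ∈ ℕ⁺ ] i ∈f β × value i ≡ min β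
  min∈ β = go (some β) (List⁺.tail (elements β))
    where
    go : ∀ x xs → Σ[ i ∈ ℕ⁺ ] i ∈ₗ x ∷ xs × value i ≡ List⁺.foldr₁ ℕ._⊓_ (List⁺.map value (List⁺._∷_ x xs))
    go x []       = x , here refl , refl
    go x (y ∷ xs) with ℕ.⊓-sel (value x) (List⁺.foldr₁ ℕ._⊓_ (List⁺.map value (List⁺._∷_ y xs)))
    ... | inj₁ ≡x = x , here refl , sym ≡x
    ... | inj₂ ≡r with i , i∈ , ≡min ← go y xs = i , there i∈ , trans ≡min (sym ≡r)

  <f-intro : ∀ (β γ : 𝒫f ℕ⁺) → (∀ {i j} → i ∈f β → j ∈f γ → value i < value j) → β <f γ
  <f-intro β γ below with i , i∈ , ≡max ← max∈ β | j , j∈ , ≡min ← min∈ γ =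
    subst₂ _<_ ≡max ≡min (below i∈ j∈)

  <f-elim : ∀ (β γ : 𝒫f ℕ⁺) → β <f γ → ∀ {i j} → i ∈f β → j ∈f γ → value i < value j
  <f-elim β γ β<γ i∈ j∈ = ℕ.≤-<-trans (∈⇒≤max β i∈) (ℕ.<-≤-trans β<γ (∈⇒min≤ γ j∈))

  -- Consecutive intervals of indices

  index : ℕ → ℕ⁺
  index i = mkℕ⁺ (suc i)

  pred⁺ : ℕ⁺ → ℕ
  pred⁺ i = ℕ.pred (value i)

  suc-pred⁺ : ∀ i → suc (pred⁺ i) ≡ value i
  suc-pred⁺ (mkℕ⁺ n) = ℕ.suc-pred n

  range : ℕ → ℕ → List ℕ⁺
  range a zero    = []
  range a (suc n) = index a ∷ range (suc a) n

  ∈-range⁻ : ∀ a n {j} → j ∈ₗ range a n → a < value j × value j ≤ a ℕ.+ n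
  ∈-range⁻ a (suc n) (here refl) = ℕ.≤-refl , subst (suc a ≤_) (sym (ℕ.+-suc a n)) (s≤s (ℕ.m≤m+n a n))
  ∈-range⁻ a (suc n) {j} (there j∈) with a<j , j≤ ← ∈-range⁻ (suc a) n j∈ =
    ℕ.<-trans (ℕ.n<1+n a) a<j , subst (value j ≤_) (sym (ℕ.+-suc a n)) j≤

  range-unique : ∀ a n → Unique (range a n)
  range-unique a zero    = []
  range-unique a (suc n) =
    ListAll.tabulate (λ j∈ a≡j → ℕ.<-irrefl (cong value a≡j) (proj₁ (∈-range⁻ (suc a) n j∈))) ∷
    range-unique (suc a) n

  -- The set {a+1, ..., a+n+1}: positions count from 0, indices from 1, and `n` is one less than the
  -- length, so that no interval is empty.
  interval : ℕ → ℕ → 𝒫f ℕ⁺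
  interval a n .elements = List⁺._∷_ (index a) (range (suc a) n)
  interval a n .𝒫f.distinct = range-unique a (suc n)

  intervals : ∀ {k} → ℕ → Vec ℕ k → Vec (𝒫f ℕ⁺) k
  intervals a []       = []
  intervals a (n ∷ ns) = interval a n ∷ intervals (a ℕ.+ suc n) ns

  intervals-linked : ∀ {k} a (ns : Vec ℕ k) → Linked _<f_ (intervals a ns)
  intervals-linked a []            = []
  intervals-linked a (n ∷ [])      = [-]
  intervals-linked a (n ∷ n′ ∷ ns) =
    <f-intro (interval a n) (interval (a ℕ.+ suc n) n′) (λ i∈ j∈ → ℕ.≤-<-trans
      (proj₂ (∈-range⁻ a (suc n) i∈)) (proj₁ (∈-range⁻ (a ℕ.+ suc n) (suc n′) j∈))) ∷
    intervals-linked (a ℕ.+ suc n) (n′ ∷ ns)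

  consecutiveSum : (ℕ → ℕ⁺) → ℕ → ℕ → ℕ⁺
  consecutiveSum g a zero    = g a
  consecutiveSum g a (suc n) = g a + consecutiveSum g (suc a) n

  consecutiveSums : ∀ {k} → (ℕ → ℕ⁺) → ℕ → Vec ℕ k → Vec ℕ⁺ k
  consecutiveSums g a []       = []
  consecutiveSums g a (n ∷ ns) = consecutiveSum g a n ∷ consecutiveSums g (a ℕ.+ suc n) ns

  ∑-interval : ∀ g a n → ∑ (interval a n) g ≡ consecutiveSum (g ∘ index) a n
  ∑-interval g a zero    = refl
  ∑-interval g a (suc n) = cong (g (index a) +_) (∑-interval g (suc a) n)

  ∑-intervals : ∀ {k} g a (ns : Vec ℕ k) →
    map (λ β → ∑ β g) (intervals a ns) ≡ consecutiveSums (g ∘ index) a ns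
  ∑-intervals g a []       = refl
  ∑-intervals g a (n ∷ ns) = cong₂ _∷_ (∑-interval g a n) (∑-intervals g (a ℕ.+ suc n) ns)

  consecutiveSum-shift : ∀ g b a n →
    consecutiveSum g (b ℕ.+ a) n ≡ consecutiveSum (λ i → g (b ℕ.+ i)) a n
  consecutiveSum-shift g b a zero    = refl
  consecutiveSum-shift g b a (suc n) = cong (g (b ℕ.+ a) +_)
    (trans (cong (λ c → consecutiveSum g c n) (sym (ℕ.+-suc b a))) (consecutiveSum-shift g b (suc a) n))

  consecutiveSums-shift : ∀ {k} g b a (ns : Vec ℕ k) →
    consecutiveSums g (b ℕ.+ a) ns ≡ consecutiveSums (λ i → g (b ℕ.+ i)) a ns
  consecutiveSums-shift g b a []       = refl
  consecutiveSums-shift g b a (n ∷ ns) = cong₂ _∷_ (consecutiveSum-shift g b a n)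
    (trans (cong (λ c → consecutiveSums g c ns) (ℕ.+-assoc b a (suc n)))
      (consecutiveSums-shift g b (a ℕ.+ suc n) ns))

  module Blocks (α : 𝒫f Fun → ℕ⁺) (H : 𝒫f Fun → 𝒫f ℕ⁺)
    (H-increasing : ∀ F G → F ⊊f G → max (H F) < min (H G)) where

    open Chains α H H-increasing

    data Blocks (F : 𝒫f Fun) : ∀ {k} → Pred (Vec ℕ⁺ k) 0ℓ where
      []  : Blocks F []
      _∷_ : ∀ {G x k} {v : Vec ℕ⁺ k} → Chain F G x → Blocks G v → Blocks F (x ∷ v)

    -- Almost every `x` is a chain sum from `F`; the end of its chain is the start for the remaining
    -- coordinates.
    tensor-blocks : ∀ {p} → chainSums ≼ (p ∋_) → ∀ k F A →
      (∀ {v} → Blocks F v → A v) → Tensor p k A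
    tensor-blocks chains≼p zero    F A blocks⊆A = blocks⊆A []
    tensor-blocks chains≼p (suc k) F A blocks⊆A = chains≼p _
      (F , λ {G} c → tensor-blocks chains≼p k G _ λ bs → blocks⊆A (c ∷ bs))

    record Path (F : 𝒫f Fun) : Set where
      field
        set    : ℕ → 𝒫f Fun
        choice : ℕ → Fun
        first  : F ⊊f set 0
        rising : ∀ i → set i ⊊f set (suc i)
        member : ∀ i → choice i ∈f set i

      terms : ℕ → ℕ⁺
      terms i = term (set i) (choice i)

    open Path

    -- Statement (1) speaks of infinite sequences, so a finite chain is continued past its last set.
    infinitePath : ∀ F → Path F
    infinitePath F = record
      { set    = set′
      ; choice = λ i → some (set′ i)
      ; first  = proj₂ (enlarge F)
      ; rising = λ i → proj₂ (enlarge (set′ i))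
      ; member = λ i → some∈ (set′ i)
      }
      where
      set′ : ℕ → 𝒫f Fun
      set′ zero    = proj₁ (enlarge F)
      set′ (suc i) = proj₁ (enlarge (set′ i))

    prepend : ∀ {F} G {f} → F ⊊f G → f ∈f G → Path G → Path F
    prepend G {f} F⊊G f∈G π = record
      { set    = λ { zero → G   ; (suc i) → set π i }
      ; choice = λ { zero → f   ; (suc i) → choice π i }
      ; first  = F⊊G
      ; rising = λ { zero → first π ; (suc i) → rising π i }
      ; member = λ { zero → f∈G ; (suc i) → member π i }
      }

    chain-path : ∀ {F G x} → Chain F G x → (π : Path G) →
      Σ[ ρ ∈ Path F ] Σ[ n ∈ ℕ ] consecutiveSum (terms ρ) 0 n ≡ x ×
        (∀ i → terms ρ (suc n ℕ.+ i) ≡ terms π i)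
    chain-path (one {G} F⊊G f∈G) π = prepend G F⊊G f∈G π , 0 , refl , λ _ → refl
    chain-path (more {G} {f = f} F⊊G f∈G c) π =
      let ρ , n , ≡x , tail≡ = chain-path c π
          σ = prepend G F⊊G f∈G ρ
      in σ , suc n ,
         cong (term G f +_) (trans (consecutiveSum-shift (terms σ) 1 0 n) ≡x) , tail≡

    blocks-path : ∀ {F k} {v : Vec ℕ⁺ k} → Blocks F v →
      Σ[ π ∈ Path F ] Σ[ ns ∈ Vec ℕ k ] consecutiveSums (terms π) 0 ns ≡ v
    blocks-path {F} []   = infinitePath F , [] , refl
    blocks-path (c ∷ bs) =
      let π , ns , ≡v = blocks-path bs
          ρ , n , ≡x , tail≡ = chain-path c π
      in ρ , n ∷ ns , cong₂ _∷_ ≡x (begin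
        consecutiveSums (terms ρ) (suc n) ns
          ≡⟨ cong (λ a → consecutiveSums (terms ρ) a ns) (ℕ.+-identityʳ (suc n)) ⟨
        consecutiveSums (terms ρ) (suc n ℕ.+ 0) ns
          ≡⟨ consecutiveSums-shift (terms ρ) (suc n) 0 ns ⟩
        consecutiveSums (λ i → terms ρ (suc n ℕ.+ i)) 0 ns
          ≡⟨ cong (λ g → consecutiveSums g 0 ns) (ext _ _ tail≡) ⟩
        consecutiveSums (terms π) 0 ns
          ≡⟨ ≡v ⟩
        _ ∎)
      where open ≡-Reasoning

    idempotent∋ : ∀ k (B : Pred (Vec ℕ⁺ (suc k)) 0ℓ) →
      ((G : ℕ⁺ → 𝒫f Fun) → (∀ i → G i ⊊f G (suc⁺ i)) →
        (β : Vec (𝒫f ℕ⁺) (suc k)) → Linked _<f_ β →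
        (f : ℕ⁺ → Fun) → (∀ i → f i ∈f G i) →
        B (map (λ βⱼ → ∑ βⱼ (λ i → α (G i) + ∑ (H (G i)) (f i))) β)) →
      Σ[ p ∈ Ultrafilter ℕ⁺ ] p ∈ 𝒥 × Idempotent p × ⨂ (suc k) (const p) ∋ B
    idempotent∋ k B sums∈B =
      let p , p∈𝒥 , p-idem , chains≼p = chainSums-idempotent
      in p , p∈𝒥 , p-idem , Equivalence.from (⨂⇔tensor p k B)
        (tensor-blocks chains≼p (suc k) (fromList (const one⁺) []) B blocks⊆B)
      where
      blocks⊆B : ∀ {F v} → Blocks F v → B v
      blocks⊆B bs =
        let π , ns , ≡v = blocks-path bs
            G = set π ∘ pred⁺
            f = choice π ∘ pred⁺
        in subst B (trans (∑-intervals (λ i → term (G i) (f i)) 0 ns) ≡v)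
          (sums∈B G
            (λ i → subst (λ j → G i ⊊f set π j) (suc-pred⁺ i) (rising π (pred⁺ i)))
            (intervals 0 ns) (intervals-linked 0 ns) f (λ i → member π (pred⁺ i)))

  -- Recursive choice of α and H

  open Sort (On.decTotalOrder ℕ.≤-decTotalOrder value) using (sort; sort-↭; sort-↗)

  -- Block sums are built in increasing order of the indices, whereas the enumeration of `β` is
  -- arbitrary.
  record Sorting (β : 𝒫f ℕ⁺) : Set where
    field
      sorted    : 𝒫f ℕ⁺
      permuted  : ⟦ sorted ⟧ ↭ ⟦ β ⟧
      ascending : AllPairs (λ i j → value i < value j) ⟦ sorted ⟧

  sorting : ∀ β → Sorting β
  sorting β with sort ⟦ β ⟧ | sort-↭ ⟦ β ⟧ | sort-↗ ⟦ β ⟧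
  ... | []     | ↭β | _ = contradiction (∈-resp-↭ (↭-sym ↭β) (some∈ β)) λ ()
  ... | i ∷ is | ↭β | ↗ = record
    { sorted    = mk𝒫f (List⁺._∷_ i is) unique
    ; permuted  = ↭β
    ; ascending = AllPairs.zipWith (λ (i≤j , i≢j) → ℕ.≤∧≢⇒< i≤j (i≢j ∘ value-injective))
        (Linked⇒AllPairs ℕ.≤-trans ↗ , unique)
    }
    where
    unique : Unique (i ∷ is)
    unique = Unique-resp-↭ (setoid ℕ⁺) (↭⇒↭ₛ (↭-sym ↭β)) (𝒫f.distinct β)

  ∑-↭ : ∀ (β γ : 𝒫f ℕ⁺) g → ⟦ β ⟧ ↭ ⟦ γ ⟧ → ∑ β g ≡ ∑ γ g
  ∑-↭ β γ g β↭γ = value-injective (begin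
    value (∑ β g)                    ≡⟨ value-∑ β g ⟩
    sum (List.map (value ∘ g) ⟦ β ⟧) ≡⟨ sum-↭ (map⁺ (value ∘ g) β↭γ) ⟩
    sum (List.map (value ∘ g) ⟦ γ ⟧) ≡⟨ value-∑ γ g ⟨
    value (∑ γ g)                    ∎)
    where open ≡-Reasoning

  -- The J-set property is applied to the functions t ↦ f(t + N + 1); moving the index set by N + 1
  -- gives the same sums beyond `N`.
  JSet-above : ∀ C → IsJSet C → ∀ N g gs →
    Σ[ a ∈ ℕ⁺ ] Σ[ β ∈ 𝒫f ℕ⁺ ] N < min β × (∀ {f} → f ∈ₗ g ∷ gs → C (a + ∑ β f))
  JSet-above C C-J N g gs =
    let a , β , ∈C = C-J (fromList (g ∘ translate) (List.map (_∘ translate) gs))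
        i , i∈ , ≡min = min∈ (translated β)
        j , j∈ , i≡ = ∈-map⁻ translate {xs = ⟦ β ⟧} i∈
    in a , translated β ,
       subst (N <_) (trans (cong value (sym i≡)) ≡min) (ℕ.m≤n+m (suc N) (value j)) ,
       λ {f} f∈ → subst (λ s → C (a + s)) (cong (List⁺.foldr₁ _+_) (List⁺.map-∘ (elements β)))
         (∈C _ (∈-fromList⁺ _ _ (∈-map⁺ (_∘ translate) f∈)))
    where
    translate : ℕ⁺ → ℕ⁺
    translate t = t + index N

    translated : 𝒫f ℕ⁺ → 𝒫f ℕ⁺
    translated β .elements = List⁺.map translate (elements β)
    translated β .𝒫f.distinct =
      Unique.map⁺ {f = translate} (λ {s} {t} eq →
        value-injective (ℕ.+-cancelʳ-≡ (suc N) (value s) (value t) (cong value eq))) (𝒫f.distinct β)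

  -- Finiteness and recursion on finite sets

  Enumerable : ∀ {a b} {Y : Set a} → Pred Y b → Set (a ⊔ b)
  Enumerable {Y = Y} P = Σ[ ys ∈ List Y ] (∀ {y} → P y → y ∈ₗ ys)

  enumerable-⊆ : ∀ {a b c} {Y : Set a} {P : Pred Y b} {Q : Pred Y c} →
    Q ⊆ P → Enumerable P → Enumerable Q
  enumerable-⊆ Q⊆P (ys , P⊆ys) = ys , λ q → P⊆ys (Q⊆P q)

  enumerable-Σ : ∀ {a b c d} {Y : Set a} {Z : Set b} {P : Pred Y c} {Q : Y → Pred Z d} →
    Enumerable P → (∀ {y} → P y → Enumerable (Q y)) →
    Enumerable (λ z → Σ[ y ∈ Y ] P y × Q y z)
  enumerable-Σ {Y = Y} {Z} {P} {Q} (ys , P⊆ys) Q-enum =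
    List.concatMap list ys , λ (y , p , q) →
      ∈-concatMap⁺ list (Any.map (λ { refl → ∈-list p q }) (P⊆ys p))
    where
    list : Y → List Z
    -- `ys` may contain elements outside `P`, for which `Q-enum` supplies no list.
    list y with decide (P y)
    ... | yes p = proj₁ (Q-enum p)
    ... | no _  = []

    ∈-list : ∀ {y z} → P y → Q y z → z ∈ₗ list y
    ∈-list {y} p q with decide (P y)
    ... | yes p′ = proj₂ (Q-enum p′) q
    ... | no ¬p  = contradiction p ¬p

  -- Finite sets of functions are represented by their indicators, so that
  -- extensionally equal sets are propositionally equal.
  Indicator : Set
  Indicator = Fun → Bool

  infix 4 _∈χ_ _⊑_ _⊏_

  _∈χ_ : Fun → Indicator → Set
  f ∈χ S = T (S f)

  χ : 𝒫f Fun → Indicator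
  χ F f = ⌊ decide (f ∈f F) ⌋

  χ-cong : ∀ F G → F ≈f G → χ F ≡ χ G
  χ-cong F G (F⊆G , G⊆F) = ext _ _ λ f → ⌊⌋-cong F⊆G G⊆F

  _⊑_ : Indicator → Indicator → Set
  S ⊑ S′ = ∀ {f} → f ∈χ S → f ∈χ S′

  ⊑-antisym : ∀ S S′ → S ⊑ S′ → S′ ⊑ S → S ≡ S′
  ⊑-antisym S S′ S⊑S′ S′⊑S = ext _ _ λ f → T-ext (S f) (S′ f) S⊑S′ S′⊑S
    where
    T-ext : ∀ b c → (T b → T c) → (T c → T b) → b ≡ c
    T-ext false false _ _ = refl
    T-ext true  true  _ _ = refl
    T-ext false true  _ g = ⊥-elim (g _)
    T-ext true  false f _ = ⊥-elim (f _)

  Finite : Indicator → Set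
  Finite S = Enumerable (_∈χ S)

  χ-finite : ∀ F → Finite (χ F)
  χ-finite F = ⟦ F ⟧ , unpack

  -- Finiteness of the larger set is built in to make the relation well-founded on all indicators.
  record _⊏_ (S S′ : Indicator) : Set where
    constructor strict
    field
      finite  : Finite S′
      subset  : S ⊑ S′
      {extra} : Fun
      extra∈  : extra ∈χ S′
      extra∉  : ¬ extra ∈χ S

  finite-⊏ : ∀ {S S′} → S ⊏ S′ → Finite S
  finite-⊏ (strict fin S⊑S′ _ _) = enumerable-⊆ S⊑S′ fin

  ⊏-trans : ∀ {S S′ S″} → S ⊏ S′ → S′ ⊏ S″ → S ⊏ S″
  ⊏-trans (strict _ S⊑S′ f∈ f∉) (strict fin S′⊑S″ _ _) = strict fin (S′⊑S″ ∘ S⊑S′) (S′⊑S″ f∈) f∉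

  ⊊⇒⊏ : ∀ F G → F ⊊f G → χ F ⊏ χ G
  ⊊⇒⊏ F G (F⊆G , F≉G) with decide (Σ[ f ∈ Fun ] f ∈f G × ¬ f ∈f F)
  ... | yes (f , f∈G , f∉F) =
    strict (χ-finite G) (λ f∈ → pack (F⊆G (unpack f∈))) (pack f∈G) (f∉F ∘ unpack)
  ... | no none = ⊥-elim (F≉G (F⊆G , λ {f} f∈G → byContradiction λ f∉F → none (f , f∈G , f∉F)))

  subset-enumerable : ∀ fs → Enumerable (λ S → ∀ {f} → f ∈χ S → f ∈ₗ fs)
  subset-enumerable [] = (λ _ → false) ∷ [] , λ {S} S⊆[] →
    here (⊑-antisym S _ (λ f∈ → contradiction (S⊆[] f∈) λ ()) λ ())
  subset-enumerable (g ∷ fs) with subsets , ∈subsets ← subset-enumerable fs =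
    subsets ++ List.map insert subsets , enumerates
    where
    insert remove : Indicator → Indicator
    insert S f = ⌊ decide (f ≡ g ⊎ f ∈χ S) ⌋
    remove S f = ⌊ decide (¬ f ≡ g × f ∈χ S) ⌋

    insert-remove : ∀ S → g ∈χ S → insert (remove S) ≡ S
    insert-remove S g∈ = ⊑-antisym _ S
      (λ f∈ → [ (λ { refl → g∈ }) , (λ f∈′ → proj₂ (unpack f∈′)) ] (unpack f∈))
      (λ {f} f∈ → pack (Sum.map₂ (λ f≢g → pack (f≢g , f∈)) (toSum (f ≟ g))))

    enumerates : ∀ {S} → (∀ {f} → f ∈χ S → f ∈ₗ g ∷ fs) → S ∈ₗ subsets ++ List.map insert subsets
    enumerates {S} S⊆ with decide (g ∈χ S)
    ... | yes g∈ = ∈-++⁺ʳ subsets (subst (_∈ₗ _) (insert-remove S g∈) (∈-map⁺ insert (∈subsets remove⊆)))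
      where
      remove⊆ : ∀ {f} → f ∈χ remove S → f ∈ₗ fs
      remove⊆ f∈ with f≢g , f∈S ← unpack f∈ with S⊆ f∈S
      ... | here f≡g  = contradiction f≡g f≢g
      ... | there f∈′ = f∈′
    ... | no g∉ = ∈-++⁺ˡ (∈subsets S⊆′)
      where
      S⊆′ : ∀ {f} → f ∈χ S → f ∈ₗ fs
      S⊆′ f∈ with S⊆ f∈
      ... | here refl = contradiction f∈ g∉
      ... | there f∈′ = f∈′

  ⊏-enumerable : ∀ {S} → Finite S → Enumerable (_⊏ S)
  ⊏-enumerable (fs , S⊆fs) =
    enumerable-⊆ (λ (strict _ S′⊑S _ _) f∈ → S⊆fs (S′⊑S f∈)) (subset-enumerable fs)

  -- `S` itself may be infinite, but its predecessors are finite; below such a one, the number of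
  -- members counted along a fixed list decreases.
  ⊏-wellFounded : WellFounded _⊏_
  ⊏-wellFounded S = acc λ {S′} S′⊏S →
    let fs , S′⊆fs = finite-⊏ S′⊏S in accessible _ S′ fs S′⊆fs ℕ.≤-refl
    where
    bit : Bool → ℕ
    bit true  = 1
    bit false = 0

    bit-mono : ∀ b c → (T b → T c) → bit b ≤ bit c
    bit-mono false _     _ = z≤n
    bit-mono true  true  _ = ℕ.≤-refl
    bit-mono true  false f = ⊥-elim (f _)

    bit-strict : ∀ b c → ¬ T b → T c → bit b < bit c
    bit-strict false true  _  _ = ℕ.≤-refl
    bit-strict true  _     ¬t _ = ⊥-elim (¬t _)

    count : Indicator → List Fun → ℕ
    count S fs = sum (List.map (bit ∘ S) fs)

    count-mono : ∀ {S S′} → S ⊑ S′ → ∀ fs → count S fs ≤ count S′ fs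
    count-mono S⊑S′ []       = z≤n
    count-mono S⊑S′ (f ∷ fs) = ℕ.+-mono-≤ (bit-mono _ _ S⊑S′) (count-mono S⊑S′ fs)

    count-strict : ∀ {S S′ f} → S ⊑ S′ → ¬ f ∈χ S → f ∈χ S′ → ∀ {fs} → f ∈ₗ fs →
      count S fs < count S′ fs
    count-strict S⊑S′ f∉ f∈ {_ ∷ fs} (here refl) =
      ℕ.+-mono-<-≤ (bit-strict _ _ f∉ f∈) (count-mono S⊑S′ fs)
    count-strict S⊑S′ f∉ f∈ (there f∈fs) =
      ℕ.+-mono-≤-< (bit-mono _ _ S⊑S′) (count-strict S⊑S′ f∉ f∈ f∈fs)

    accessible : ∀ n S fs → (∀ {f} → f ∈χ S → f ∈ₗ fs) → count S fs < n → Acc _⊏_ S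
    accessible (suc n) S fs S⊆fs count<n = acc λ {S′} (strict _ S′⊑S f∈ f∉) →
      accessible n S′ fs (S⊆fs ∘ S′⊑S)
        (ℕ.<-≤-trans (count-strict S′⊑S f∉ f∈ (S⊆fs f∈)) (ℕ.s≤s⁻¹ count<n))

  -- The game of building block sums

  State : Set₁
  State = Σ[ k ∈ ℕ ] Pred (Vec ℕ⁺ k) 0ℓ

  Value : Set
  Value = ℕ⁺ × 𝒫f ℕ⁺

  eval : Value → Fun → ℕ⁺
  eval (a , β) f = a + ∑ β f

  close : ∀ {k} → Pred (Vec ℕ⁺ (suc k)) 0ℓ → ℕ⁺ → Pred (Vec ℕ⁺ k) 0ℓ
  close A y v = A (y ∷ v)

  continue : ∀ {k} → Pred (Vec ℕ⁺ (suc k)) 0ℓ → ℕ⁺ → Pred (Vec ℕ⁺ (suc k)) 0ℓ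
  continue A y v = A ((y + head v) ∷ tail v)

  -- A state (k , A) asks for k more block sums whose vector lies in A.  A new
  -- summand y opens a block, which either ends with y or goes on.
  successors : State → ℕ⁺ → List State
  successors (zero  , A) y = []
  successors (suc k , A) y = (k , close A y) ∷ (suc k , continue A y) ∷ []

  module Strategy (p : Ultrafilter ℕ⁺) (p∈𝒥 : p ∈ 𝒥) (p-idem : Idempotent p) where

    p-filter = ultrafilter-isFilter p

    Valid : State → Set
    Valid (k , A) = Tensor p k A

    Admissible : State → Pred ℕ⁺ 0ℓ
    Admissible (zero  , A) y = ⊤
    Admissible (suc k , A) y = Valid (k , close A y) × Valid (suc k , continue A y)

    -- Closing the block is the definition of `Tensor`; going on with it is idempotency of `p`.
    admissible-∋ : ∀ s → Valid s → p ∋ Admissible s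
    admissible-∋ (zero  , A) _     = ∋-U p-filter
    admissible-∋ (suc k , A) valid =
      ∋-∩ p-filter valid (Equivalence.from (p-idem λ y → Valid (k , close A y)) valid)

    successor-valid : ∀ s {y s′} → Admissible s y → s′ ∈ₗ successors s y → Valid s′
    successor-valid (suc k , A) (closed , _)    (here refl)         = closed
    successor-valid (suc k , A) (_ , continued) (there (here refl)) = continued

    module _ (initial : State) where

      -- Depends on `v` only strictly below `S`. A play may begin late and skip sets, as blocks need
      -- not use all indices.
      data Reach (v : Indicator → Value) (S : Indicator) : Pred State (lsuc 0ℓ) where
        start : Reach v S initial
        next  : ∀ {S′ f s s′} → S′ ⊏ S → f ∈χ S′ → Reach v S′ s →
          s′ ∈ₗ successors s (eval (v S′) f) → Reach v S s′

      reach-cong : ∀ {v w S s} → (∀ {S′} → S′ ⊏ S → v S′ ≡ w S′) → Reach v S s → Reach w S s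
      reach-cong v≡w start = start
      reach-cong v≡w (next {f = f} {s = s} S′⊏S f∈ r s′∈) =
        next S′⊏S f∈ (reach-cong (λ S″⊏S′ → v≡w (⊏-trans S″⊏S′ S′⊏S)) r)
          (subst (λ y → _ ∈ₗ successors s (eval y f)) (v≡w S′⊏S) s′∈)

      -- A last move is given by a proper subset, one of its members, and a state reached earlier:
      -- finitely many of each.
      reach-enumerable : ∀ v S → Acc _⊏_ S → Finite S → Enumerable (Reach v S)
      reach-enumerable v S (acc rs) fin =
        let ss , Σ⊆ss = enumerable-Σ (⊏-enumerable fin) λ {S′} S′⊏S →
              enumerable-Σ (finite-⊏ S′⊏S) λ {f} _ →
                enumerable-Σ (reach-enumerable v S′ (rs S′⊏S) (finite-⊏ S′⊏S)) λ {s} _ →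
                  successors s (eval (v S′) f) , id
        in initial ∷ ss , λ where
          start → here refl
          (next S′⊏S f∈ r s′∈) → there (Σ⊆ss (_ , S′⊏S , _ , f∈ , _ , r , s′∈))

      record Good (v : Indicator → Value) (S : Indicator) (w : Value) : Set₁ where
        field
          admissible : ∀ {s f} → Reach v S s → Valid s → f ∈χ S → Admissible s (eval w f)
          above      : ∀ {S′} → S′ ⊏ S → max (proj₂ (v S′)) < min (proj₂ w)

      open Good

      good-cong : ∀ {v v′ S w} → (∀ {S′} → S′ ⊏ S → v S′ ≡ v′ S′) → Good v S w → Good v′ S w
      good-cong v≡ g .admissible r = admissible g (reach-cong (λ S′⊏S → sym (v≡ S′⊏S)) r)
      good-cong v≡ g .above S′⊏S = subst (λ w′ → max (proj₂ w′) < _) (v≡ S′⊏S) (above g S′⊏S)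

      good-exists : ∀ v {S} → Finite S → ∃ (Good v S)
      good-exists v {S} fin@(fs , S⊆fs) =
        let ss , reach⊆ss = reach-enumerable v S (⊏-wellFounded S) fin
            Ss , ⊏⊆Ss = ⊏-enumerable fin
            bound = max ∘ proj₂ ∘ v
            a , β , N<β , ∈C = JSet-above (⋂ constraint ss)
              (p∈𝒥 _ (⋂-∋ p-filter constraint ss λ {s} _ → constraint-∋ s))
              -- The sum dominates every earlier maximum; `const one⁺` keeps the list of functions
              -- nonempty when `fs` is empty.
              (sum (List.map bound Ss)) (const one⁺) fs
        in (a , β) , record
          { admissible = λ r valid f∈ → ⋂-lower constraint (reach⊆ss r) (∈C (there (S⊆fs f∈))) valid
          ; above      = λ S′⊏S → ℕ.≤-<-trans (∈⇒≤sum bound (⊏⊆Ss S′⊏S)) N<β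
          }
        where
        -- As an implication it defines a member of `p` for every listed state, valid or not.
        constraint : State → Pred ℕ⁺ 0ℓ
        constraint s y = Valid s → Admissible s y

        constraint-∋ : ∀ s → p ∋ constraint s
        constraint-∋ s with decide (Valid s)
        ... | yes valid = upward p-filter (λ adm _ → adm) (admissible-∋ s valid)
        ... | no ¬valid = upward p-filter (λ _ valid → contradiction valid ¬valid) (∋-U p-filter)

      default : Value
      default = one⁺ , fromList one⁺ []

      choose : (Indicator → Value) → Indicator → Value
      choose v S with decide (∃ (Good v S))
      ... | yes (w , _) = w
      ... | no _        = default

      choose-good : ∀ v {S} → Finite S → Good v S (choose v S)
      choose-good v {S} fin with decide (∃ (Good v S))
      ... | yes (_ , good) = good
      ... | no ¬good       = contradiction (good-exists v fin) ¬good

      -- Makes a total function of the values already chosen; by `good-cong` the default outside the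
      -- proper subsets of `S` is harmless.
      extend : ∀ S → WfRec _⊏_ (λ _ → Value) S → Indicator → Value
      extend S IH S′ with decide (S′ ⊏ S)
      ... | yes S′⊏S = IH S′⊏S
      ... | no _     = default

      extend-cong : ∀ S {IH IH′ : WfRec _⊏_ (λ _ → Value) S} →
        (∀ {S′} (S′⊏S : S′ ⊏ S) → IH S′⊏S ≡ IH′ S′⊏S) → extend S IH ≡ extend S IH′
      extend-cong S {IH} {IH′} IH≡ = ext _ _ pointwise
        where
        pointwise : ∀ S′ → extend S IH S′ ≡ extend S IH′ S′
        pointwise S′ with decide (S′ ⊏ S)
        ... | yes S′⊏S = IH≡ S′⊏S
        ... | no _     = refl

      extend-⊏ : ∀ (v : Indicator → Value) {S S′} → S′ ⊏ S → extend S (λ {S′} _ → v S′) S′ ≡ v S′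
      extend-⊏ v {S} {S′} S′⊏S with decide (S′ ⊏ S)
      ... | yes _  = refl
      ... | no ¬⊏ = contradiction S′⊏S ¬⊏

      step : ∀ S → WfRec _⊏_ (λ _ → Value) S → Value
      step S IH = choose (extend S IH) S

      step-cong : ∀ S {IH IH′ : WfRec _⊏_ (λ _ → Value) S} →
        (∀ {S′} (S′⊏S : S′ ⊏ S) → IH S′⊏S ≡ IH′ S′⊏S) → step S IH ≡ step S IH′
      step-cong S IH≡ = cong (λ v → choose v S) (extend-cong S IH≡)

      strategy : Indicator → Value
      strategy = All.wfRec ⊏-wellFounded _ (λ _ → Value) step

      strategy-good : ∀ {S} → Finite S → Good strategy S (strategy S)
      strategy-good {S} fin = good-cong (extend-⊏ strategy)
        (subst (Good _ S) (sym (unfold-wfRec {S})) (choose-good (extend S λ {S′} _ → strategy S′) fin))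
        where open FixPoint ⊏-wellFounded (λ _ → Value) step step-cong

      reach-valid : Valid initial → ∀ {S s} → Reach strategy S s → Valid s
      reach-valid valid start = valid
      reach-valid valid (next {s = s} S′⊏S f∈ r s′∈) = successor-valid s
        (admissible (strategy-good (finite-⊏ S′⊏S)) r (reach-valid valid r) f∈) s′∈

      module _ (G : ℕ⁺ → 𝒫f Fun) (rising : ∀ i → G i ⊊f G (suc⁺ i))
        (f : ℕ⁺ → Fun) (f∈G : ∀ i → f i ∈f G i) where

        S : ℕ⁺ → Indicator
        S i = χ (G i)

        y : ℕ⁺ → ℕ⁺
        y i = eval (strategy (S i)) (f i)

        S-rising : ∀ {i j} → value i < value j → S i ⊏ S j
        S-rising {i} {j} i<j = subst₂ (λ i j → S i ⊏ S j) (index-pred i) (index-pred j)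
          (go (ℕ.s<s⁻¹ (subst₂ _<_ (sym (suc-pred⁺ i)) (sym (suc-pred⁺ j)) i<j)))
          where
          index-pred : ∀ i → index (pred⁺ i) ≡ i
          index-pred i = value-injective (suc-pred⁺ i)

          go : ∀ {m n} → m < n → S (index m) ⊏ S (index n)
          go {m} {suc n} m<n with ℕ.m≤n⇒m<n∨m≡n (ℕ.s≤s⁻¹ m<n)
          ... | inj₁ m<n′ = ⊏-trans (go m<n′) (⊊⇒⊏ (G (index n)) (G (suc⁺ (index n))) (rising (index n)))
          ... | inj₂ refl = ⊊⇒⊏ (G (index n)) (G (suc⁺ (index n))) (rising (index n))

        advance : ∀ {i j s s′} → value i < value j → Reach strategy (S i) s →
          s′ ∈ₗ successors s (y i) → Reach strategy (S j) s′
        advance {i} i<j = next (S-rising i<j) (pack (f∈G i))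

        -- Every summand but the last continues the block and the last closes it; continuing by `y`
        -- and closing with `z` amounts to closing with `y + z`.
        reach-block : ∀ i is {k} {A : Pred (Vec ℕ⁺ (suc k)) 0ℓ} →
          AllPairs (λ i j → value i < value j) (i ∷ is) → Reach strategy (S i) (suc k , A) →
          ∀ {j} → (∀ {i′} → i′ ∈ₗ i ∷ is → value i′ < value j) →
          Reach strategy (S j) (k , close A (List⁺.foldr₁ _+_ (List⁺.map y (List⁺._∷_ i is))))
        reach-block i []        _                    r <j = advance (<j (here refl)) r (here refl)
        reach-block i (i′ ∷ is) ((i<i′ ListAll.∷ _) ∷ ↗) r <j =
          reach-block i′ is ↗ (advance i<i′ r (there (here refl))) (<j ∘ there)

        reach-close : ∀ β {k} {A : Pred (Vec ℕ⁺ (suc k)) 0ℓ} →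
          (∀ {i} → i ∈f β → Reach strategy (S i) (suc k , A)) →
          ∀ {j} → (∀ {i} → i ∈f β → value i < value j) →
          Reach strategy (S j) (k , close A (∑ β y))
        reach-close β {k} {A} r {j} <j =
          subst (λ x → Reach strategy (S j) (k , close A x)) (∑-↭ sorted β y permuted)
            (reach-block (some sorted) (List⁺.tail (elements sorted)) ascending
              (r (∈-resp-↭ permuted (some∈ sorted))) (<j ∘ ∈-resp-↭ permuted))
          where open Sorting (sorting β)

        -- After the last block the state is `(0 , A′)`, whose validity says that the vector of
        -- block sums lies in `A`.
        blockSums∈ : Valid initial → ∀ {k} (β : 𝒫f ℕ⁺) (βs : Vec (𝒫f ℕ⁺) k) →
          Linked _<f_ (β ∷ βs) → ∀ {A} → (∀ {i} → i ∈f β → Reach strategy (S i) (suc k , A)) →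
          A (map (λ β → ∑ β y) (β ∷ βs))
        -- Any index beyond `max β` provides a set above all those used.
        blockSums∈ valid β [] _ r = reach-valid valid
          (reach-close β r {suc⁺ (index (max β))} λ i∈ → ℕ.m≤n⇒m≤1+n (s≤s (∈⇒≤max β i∈)))
        blockSums∈ valid β (γ ∷ βs) (β<γ ∷ linked) r =
          blockSums∈ valid γ βs linked λ j∈ → reach-close β r λ i∈ → <f-elim β γ β<γ i∈ j∈

-- The equivalence of (1) and (2)

corollary1p32 : (∀ ℓ → ExcludedMiddle ℓ) →
    (∀ a b → Extensionality a b) →
    (m : ℕ) .{{_ : NonZero m}} →
    (h : Vec ℕ⁺ m → ℕ⁺) → IsPolynomialWithoutConstantTerm h →
    (A : Pred ℕ⁺ 0ℓ) →
    (Σ[ α ∈ (𝒫f-setoid Fun ⟶ₛ setoid ℕ⁺) ] Σ[ H ∈ (𝒫f-setoid Fun ⟶ₛ 𝒫f-setoid ℕ⁺) ]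
    ((∀ F G → F ⊊f G → max (H ⟨$⟩ F) < min (H ⟨$⟩ G)) ×
    ((G : ℕ⁺ → 𝒫f Fun) → (∀ i → G i ⊊f G (suc⁺ i)) →
    (β : Vec (𝒫f ℕ⁺) m) → Linked _<f_ β →
    (f : ℕ⁺ → Fun) → (∀ i → f i ∈f G i) →
    h (map (λ βⱼ → ∑ βⱼ (λ i → (α ⟨$⟩ G i) + ∑ (H ⟨$⟩ G i) (f i))) β) ∈ A)))
    ⇔
    (Σ[ p ∈ Ultrafilter ℕ⁺ ]
    (p ∈ 𝒥 × Idempotent p × extension h (⨂ m (const p)) ∋ A))
corollary1p32 em ext m@(suc k) h _ A = mk⇔ to from
  where
  open Classical em ext

  B : Pred (Vec ℕ⁺ m) 0ℓ
  B v = h v ∈ A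

  to : _
  to (α , H , H-increasing , sums∈A) =
    Blocks.idempotent∋ (α ⟨$⟩_) (H ⟨$⟩_) H-increasing k B sums∈A

  from : _
  from (p , p∈𝒥 , p-idem , p∋) = α , H , H-increasing , sums∈A
    where
    open Strategy p p∈𝒥 p-idem

    valid : Valid (m , B)
    valid = Equivalence.to (⨂⇔tensor p k B) p∋

    σ : 𝒫f Fun → Value
    σ F = strategy (m , B) (χ F)

    σ-cong : ∀ {F G} → F ≈f G → σ F ≡ σ G
    σ-cong {F} {G} F≈G = cong (strategy (m , B)) (χ-cong F G F≈G)

    α : 𝒫f-setoid Fun ⟶ₛ setoid ℕ⁺
    α = record { to = proj₁ ∘ σ ; cong = λ {F} {G} F≈G → cong proj₁ (σ-cong {F} {G} F≈G) }

    H : 𝒫f-setoid Fun ⟶ₛ 𝒫f-setoid ℕ⁺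
    H = record
      { to   = proj₂ ∘ σ
      ; cong = λ {F} {G} F≈G → Setoid.reflexive (𝒫f-setoid ℕ⁺) (cong proj₂ (σ-cong {F} {G} F≈G))
      }

    H-increasing : ∀ F G → F ⊊f G → max (H ⟨$⟩ F) < min (H ⟨$⟩ G)
    H-increasing F G F⊊G = Good.above (strategy-good (m , B) (χ-finite G)) (⊊⇒⊏ F G F⊊G)

    sums∈A : (G : ℕ⁺ → 𝒫f Fun) → (∀ i → G i ⊊f G (suc⁺ i)) →
      (β : Vec (𝒫f ℕ⁺) m) → Linked _<f_ β →
      (f : ℕ⁺ → Fun) → (∀ i → f i ∈f G i) →
      h (map (λ βⱼ → ∑ βⱼ (λ i → (α ⟨$⟩ G i) + ∑ (H ⟨$⟩ G i) (f i))) β) ∈ A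
    sums∈A G rising (β ∷ βs) linked f f∈G =
      -- The initial state is reachable at every set, so the first block may begin anywhere.
      blockSums∈ (m , B) G rising f f∈G valid β βs linked λ _ → start
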